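{- For every integer $m>1$ and every (arbitrarily small) $\varepsilon>0$, as $n\to\infty$, $$\mathbb P(G_m^n\text{ is connected})=1-O\left(\left(\frac{(\log\log n)^{1+\varepsilon}}{\log n}\right)^{\frac{m-1}{3}}\right).$$
   Context: The Bollobás–Riordan preferential attachment multigraph $G_m^n$: $G_1^1$ is a single vertex $1$ with a loop (a loop contributes $2$ to the degree); given $G_1^{t-1}$ on $[t-1]$, vertex $t$ is added together with one edge, which joins $t$ to $s\in[t-1]$ with probability $\deg_{G_1^{t-1}}(s)/(2t-1)$ and is a loop at $t$ with probability $1/(2t-1)$. $G_m^n$ is obtained from $G_1^{mn}$ by merging vertices $m(j-1)+1,\dots,mj$ into a single vertex $j$, $j=1,\dots,n$ (keeping multiple edges and loops). Equivalently (in distribution): let $w_1,\dots,w_{mn+1}$ be independent mean-$1$ exponentials, $W_k=\sum_{i\le k}w_i$, $R_k=W_k/W_{mn+1}$, $R_0=0$; conditionally on $\{W_k\}$ let $\ell_1,\dots,\ell_{mn}$ be independent, $\ell_k$ with density $\frac1{2\sqrt{R_kx}}$ on $(0,R_k]$; vertex $j$ is the interval $(R_{m(j-1)},R_{mj}]$ and for each $k\in[mn]$ there is one edge joining the vertices containing $R_k$ and $\ell_k$. The constant in $O(\cdot)$ may depend on $m$ and $\varepsilon$. -}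

module Defs where

open import Algebra.Bundles using (CommutativeRing)
open import Data.Empty using (⊥-elim)
open import Data.Fin.Base using (Fin; inject₁; fromℕ; quotient)
import Data.Fin.Properties as Fin
open import Data.Integer.Base as ℤ using (+_; -[1+_])
import Data.Integer.Properties as ℤ
open import Data.List.Base
  using (List; []; _∷_; _++_; [_]; map; concatMap; filter; foldr; allFin)
open import Data.List.Membership.Propositional using (_∈_)
open import Data.List.Relation.Unary.Any using (here; there)
open import Data.Nat.Base as ℕ using (ℕ; zero; suc)
open import Data.Nat.Coprimality using (1-coprimeTo)
import Data.Nat.Properties as ℕ
open import Data.Product.Base using (Σ; ∃; ∃-syntax; _×_; _,_; proj₁; proj₂)
import Data.Product.Base as Product
open import Data.Rational.Base hiding (truncate)
open import Data.Rational.Properties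
open import Data.Rational.Unnormalised.Base as ℚᵘ using (mkℚᵘ; *≤*)
import Data.Rational.Unnormalised.Properties as ℚᵘ
open import Data.Sum.Base using (_⊎_; inj₁; inj₂)
open import Function.Base using (_∘_)
open import Relation.Binary.Construct.Closure.Equivalence using (EqClosure)
open import Relation.Binary.Construct.Closure.ReflexiveTransitive
  using (ε; _◅_; _◅◅_)
import Relation.Binary.Construct.Closure.ReflexiveTransitive as Star
open import Relation.Binary.Construct.Closure.Symmetric using (fwd; bwd)
import Relation.Binary.Construct.Closure.Symmetric as Sym
open import Relation.Binary.Definitions using (tri<; tri≈; tri>)
open import Relation.Binary.PropositionalEquality
  using (_≡_; refl; sym; trans; cong; subst)
open import Relation.Nullary using (¬_; Dec; yes; no)
open import Relation.Nullary.Decidable using (toWitness; map′; _×-dec_; _⊎-dec_)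
open import Relation.Unary using (Decidable)

------------------------------------------------------------------------
-- Finite probability

-- A finitely supported distribution as a list of weighted outcomes; the same
-- outcome may be listed several times, and then its weights add up.
Dist : Set → Set
Dist A = List (A × ℚ)

return : ∀ {A} → A → Dist A
return a = [ a , 1ℚ ]

_>>=_ : ∀ {A B} → Dist A → (A → Dist B) → Dist B
d >>= f = concatMap (λ (a , p) → map (λ (b , q) → b , p * q) (f a)) d

mapDist : ∀ {A B : Set} → (A → B) → Dist A → Dist B
mapDist f = map (Product.map₁ f)

ℙ : ∀ {A} {P : A → Set} → Dist A → Decidable P → ℚ
ℙ d P? = foldr _+_ 0ℚ (map proj₂ (filter (P? ∘ proj₁) d))

------------------------------------------------------------------------
-- Multigraphs

-- The edges of a multigraph on Fin v, with multiplicity; (u , u) is a loop.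
-- The orientation of an edge is irrelevant to deg and Connected.
Multigraph : ℕ → Set
Multigraph v = List (Fin v × Fin v)

δ : ∀ {v} → Fin v → Fin v → ℕ
δ u w with u Fin.≟ w
... | yes _ = 1
... | no  _ = 0

-- A loop contributes 2.
deg : ∀ {v} → Multigraph v → Fin v → ℕ
deg []            s = 0
deg ((u , w) ∷ g) s = δ u s ℕ.+ δ w s ℕ.+ deg g s

Adjacent : ∀ {v} → Multigraph v → Fin v → Fin v → Set
Adjacent g u w = (u , w) ∈ g

Reachable : ∀ {v} → Multigraph v → Fin v → Fin v → Set
Reachable g = EqClosure (Adjacent g)

Connected : ∀ {v} → Multigraph v → Set
Connected g = ∀ u w → Reachable g u w

module _ {v} (a b : Fin v) (g : Multigraph v) where

  -- Reachability after adding the edge {a , b} to g.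
  Via : Fin v → Fin v → Set
  Via u w = Reachable g u w
          ⊎ (Reachable g u a × Reachable g b w)
          ⊎ (Reachable g u b × Reachable g a w)

  private
    weaken : ∀ {u w} → Reachable g u w → Reachable ((a , b) ∷ g) u w
    weaken = Star.map (Sym.map there)

  via⇒reachable : ∀ {u w} → Via u w → Reachable ((a , b) ∷ g) u w
  via⇒reachable (inj₁ p)              = weaken p
  via⇒reachable (inj₂ (inj₁ (p , q))) = weaken p ◅◅ fwd (here refl) ◅ weaken q
  via⇒reachable (inj₂ (inj₂ (p , q))) = weaken p ◅◅ bwd (here refl) ◅ weaken q

  reachable⇒via : ∀ {u w} → Reachable ((a , b) ∷ g) u w → Via u w
  reachable⇒via ε = inj₁ ε
  reachable⇒via (fwd (here refl) ◅ p) with reachable⇒via p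
  ... | inj₁ q              = inj₂ (inj₁ (ε , q))
  ... | inj₂ (inj₁ (_ , q)) = inj₂ (inj₁ (ε , q))
  ... | inj₂ (inj₂ (_ , q)) = inj₁ q
  reachable⇒via (bwd (here refl) ◅ p) with reachable⇒via p
  ... | inj₁ q              = inj₂ (inj₂ (ε , q))
  ... | inj₂ (inj₁ (_ , q)) = inj₁ q
  ... | inj₂ (inj₂ (_ , q)) = inj₂ (inj₂ (ε , q))
  reachable⇒via (fwd (there e) ◅ p) with reachable⇒via p
  ... | inj₁ q              = inj₁ (fwd e ◅ q)
  ... | inj₂ (inj₁ (q , r)) = inj₂ (inj₁ (fwd e ◅ q , r))
  ... | inj₂ (inj₂ (q , r)) = inj₂ (inj₂ (fwd e ◅ q , r))
  reachable⇒via (bwd (there e) ◅ p) with reachable⇒via p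
  ... | inj₁ q              = inj₁ (bwd e ◅ q)
  ... | inj₂ (inj₁ (q , r)) = inj₂ (inj₁ (bwd e ◅ q , r))
  ... | inj₂ (inj₂ (q , r)) = inj₂ (inj₂ (bwd e ◅ q , r))

reachable? : ∀ {v} (g : Multigraph v) u w → Dec (Reachable g u w)
reachable? [] u w = map′ (λ { refl → ε }) (λ { ε → refl ; (fwd () ◅ _) ; (bwd () ◅ _) }) (u Fin.≟ w)
reachable? ((a , b) ∷ g) u w =
  map′ (via⇒reachable a b g) (reachable⇒via a b g)
    (reachable? g u w
      ⊎-dec (reachable? g u a ×-dec reachable? g b w)
      ⊎-dec (reachable? g u b ×-dec reachable? g a w))

connected? : ∀ {v} → Decidable (Connected {v})
connected? g = Fin.all? (λ u → Fin.all? (λ w → reachable? g u w))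

------------------------------------------------------------------------
-- The preferential attachment multigraph

addVertex : ∀ {t} → Multigraph t → Fin (suc t) → Multigraph (suc t)
addVertex {t} g s = (fromℕ t , s) ∷ map (Product.map inject₁ inject₁) g

-- The vertex added to a graph on t vertices is the (t+1)-st, so the
-- normalisation is 2(t+1)-1 = 2t+1.
attach : ∀ {t} → Multigraph t → Dist (Multigraph (suc t))
attach {t} g =
  map (λ s → addVertex g (inject₁ s) , + deg g s / suc (2 ℕ.* t)) (allFin t)
  ++ [ addVertex g (fromℕ t) , + 1 / suc (2 ℕ.* t) ]

-- Started from the empty graph; the first step then gives, with probability 1,
-- a single vertex with a loop.
G₁ : ∀ N → Dist (Multigraph N)
G₁ zero    = return []
G₁ (suc t) = G₁ t >>= attach

-- With vertices numbered from 0, vertex i of G₁ becomes vertex ⌊i/m⌋.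
merge : ∀ m n → Multigraph (n ℕ.* m) → Multigraph n
merge m n = map (Product.map (quotient m) (quotient m))

G : ∀ m n → Dist (Multigraph n)
G m n = mapDist (merge m n) (G₁ (n ℕ.* m))

------------------------------------------------------------------------
-- Auxiliary facts on rationals

open CommutativeRing +-*-commutativeRing using (semiring)
open import Algebra.Properties.Semiring.Exp semiring public
  renaming (_^_ to _^ℚ_) using (^-homo-*; ^-assocʳ)

private
  0≤1 : 0ℚ ≤ 1ℚ
  0≤1 = toWitness {a? = 0ℚ ≤? 1ℚ} _

*-mono-≤⁺ : ∀ {a b c d} → 0ℚ ≤ c → 0ℚ ≤ b → a ≤ b → c ≤ d → a * c ≤ b * d
*-mono-≤⁺ {a} {b} {c} {d} 0≤c 0≤b a≤b c≤d = ≤-trans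
  (*-monoʳ-≤-nonNeg c {{nonNegative 0≤c}} a≤b)
  (*-monoˡ-≤-nonNeg b {{nonNegative 0≤b}} c≤d)

*-pos : ∀ {a b} → 0ℚ < a → 0ℚ < b → 0ℚ < a * b
*-pos {a} {b} 0<a 0<b =
  subst (_< a * b) (*-zeroˡ b) (*-monoˡ-<-pos b {{positive 0<b}} 0<a)

^-pos : ∀ {a} → 0ℚ < a → ∀ n → 0ℚ < a ^ℚ n
^-pos 0<a zero    = toWitness {a? = 0ℚ <? 1ℚ} _
^-pos 0<a (suc n) = *-pos 0<a (^-pos 0<a n)

^-≤1 : ∀ {a} → 0ℚ < a → a ≤ 1ℚ → ∀ n → a ^ℚ n ≤ 1ℚ
^-≤1 0<a a≤1 zero    = ≤-refl
^-≤1 0<a a≤1 (suc n) =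
  *-mono-≤⁺ (<⇒≤ (^-pos 0<a n)) 0≤1 a≤1 (^-≤1 0<a a≤1 n)

1≤^ : ∀ {a} → 1ℚ ≤ a → ∀ n → 1ℚ ≤ a ^ℚ n
1≤^ 1≤a zero    = ≤-refl
1≤^ 1≤a (suc n) = *-mono-≤⁺ 0≤1 (≤-trans 0≤1 1≤a) 1≤a (1≤^ 1≤a n)

^-monoˡ-≤ : ∀ {a b} → 0ℚ < a → a ≤ b → ∀ n → a ^ℚ n ≤ b ^ℚ n
^-monoˡ-≤ 0<a a≤b zero    = ≤-refl
^-monoˡ-≤ 0<a a≤b (suc n) =
  *-mono-≤⁺ (<⇒≤ (^-pos 0<a n)) (≤-trans (<⇒≤ 0<a) a≤b) a≤b (^-monoˡ-≤ 0<a a≤b n)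

^-monoˡ-< : ∀ {a b} → 0ℚ < a → a < b → ∀ n → a ^ℚ suc n < b ^ℚ suc n
^-monoˡ-< {a} {b} 0<a a<b n = <-≤-trans
  (*-monoˡ-<-pos (a ^ℚ n) {{positive (^-pos 0<a n)}} a<b)
  (*-monoˡ-≤-nonNeg b {{nonNegative (<⇒≤ (<-trans 0<a a<b))}} (^-monoˡ-≤ 0<a (<⇒≤ a<b) n))

^-monoʳ-≤ : ∀ {a} → 1ℚ ≤ a → ∀ {i j} → i ℕ.≤ j → a ^ℚ i ≤ a ^ℚ j
^-monoʳ-≤ 1≤a {j = j} ℕ.z≤n = 1≤^ 1≤a j
^-monoʳ-≤ {a} 1≤a (ℕ.s≤s i≤j) =
  *-monoˡ-≤-nonNeg a {{nonNegative (≤-trans 0≤1 1≤a)}} (^-monoʳ-≤ 1≤a i≤j)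

^-antimonoʳ-≤ : ∀ {a} → 0ℚ < a → a ≤ 1ℚ → ∀ {i j} → i ℕ.≤ j → a ^ℚ j ≤ a ^ℚ i
^-antimonoʳ-≤ 0<a a≤1 {j = j} ℕ.z≤n = ^-≤1 0<a a≤1 j
^-antimonoʳ-≤ {a} 0<a a≤1 (ℕ.s≤s i≤j) =
  *-monoˡ-≤-nonNeg a {{nonNegative (<⇒≤ 0<a)}} (^-antimonoʳ-≤ 0<a a≤1 i≤j)

≤+nonNeg : ∀ a {b} → 0ℚ ≤ b → a ≤ a + b
≤+nonNeg a {b} 0≤b = subst (_≤ a + b) (+-identityʳ a) (+-monoʳ-≤ a 0≤b)

------------------------------------------------------------------------
-- Positive real numbers

-- A positive real is a Dedekind cut, given by its lower set: x ∋ q means q < x.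
-- Nonpositive rationals belong to the lower set. Locatedness is not required;
-- classically these are exactly the positive real numbers.
record ℝ⁺ : Set₁ where
  infix 4 _∋_
  field
    _∋_     : ℚ → Set
    0∈      : _∋_ 0ℚ
    bounded : ∃ λ u → ¬ (_∋_ u)
    down    : ∀ {p q} → p < q → _∋_ q → _∋_ p
    open′   : ∀ {p} → _∋_ p → ∃ λ q → p < q × _∋_ q

open ℝ⁺ public using (_∋_)
open ℝ⁺

-- Supremum of a bounded set of rationals with a positive element.
sup : (S : ℚ → Set) → (∃ λ r → 0ℚ < r × S r) → (∃ λ u → ∀ r → S r → r ≤ u) → ℝ⁺
sup S (r , 0<r , Sr) (u , S≤u) = record
  { _∋_     = λ q → ∃ λ s → S s × q < s
  ; 0∈      = r , Sr , 0<r
  ; bounded = u , λ (s , Ss , u<s) → <-irrefl refl (<-≤-trans u<s (S≤u s Ss))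
  ; down    = λ p<q (s , Ss , q<s) → s , Ss , <-trans p<q q<s
  ; open′   = λ (s , Ss , p<s) → let (q , p<q , q<s) = <-dense p<s in
                                 q , p<q , s , Ss , q<s
  }

fromℚ : (p : ℚ) → 0ℚ < p → ℝ⁺
fromℚ p 0<p = record
  { _∋_     = _< p
  ; 0∈      = 0<p
  ; bounded = p , <-irrefl refl
  ; down    = <-trans
  ; open′   = λ q<p → let (r , q<r , r<p) = <-dense q<p in r , q<r , r<p
  }

1ℝ : ℝ⁺
1ℝ = fromℚ 1ℚ (toWitness {a? = 0ℚ <? 1ℚ} _)

infix 4 _≤ᵣ_ _<ᵣ_

_≤ᵣ_ : ℚ → ℝ⁺ → Set
p ≤ᵣ x = ∀ q → q < p → x ∋ q

_<ᵣ_ : ℝ⁺ → ℝ⁺ → Set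
x <ᵣ y = ∃ λ r → y ∋ r × ¬ (x ∋ r)

∋⇒< : ∀ x {p q} → x ∋ p → ¬ (x ∋ q) → p < q
∋⇒< x {p} {q} xp ¬xq with <-cmp p q
... | tri< p<q _ _  = p<q
... | tri≈ _ refl _ = ⊥-elim (¬xq xp)
... | tri> _ _ q<p  = ⊥-elim (¬xq (down x q<p xp))

infixl 6 _+ᵣ_
infixl 7 _*ᵣ_ _/ᵣ_
infixr 8 _^ᵣ_

_+ᵣ_ : ℝ⁺ → ℝ⁺ → ℝ⁺
x +ᵣ y = sup (λ r → ∃[ a ] ∃[ b ] x ∋ a × y ∋ b × r ≡ a + b)
  (let (a , 0<a , xa) = open′ x (0∈ x); (b , 0<b , yb) = open′ y (0∈ y)
   in a + b , +-mono-< 0<a 0<b , a , b , xa , yb , refl)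
  (let (u , ¬xu) = bounded x; (v , ¬yv) = bounded y
   in u + v , λ { _ (a , b , xa , yb , refl) →
        +-mono-≤ (<⇒≤ (∋⇒< x xa ¬xu)) (<⇒≤ (∋⇒< y yb ¬yv)) })

_*ᵣ_ : ℝ⁺ → ℝ⁺ → ℝ⁺
x *ᵣ y = sup (λ r → ∃[ a ] ∃[ b ] 0ℚ < a × 0ℚ < b × x ∋ a × y ∋ b × r ≡ a * b)
  (let (a , 0<a , xa) = open′ x (0∈ x); (b , 0<b , yb) = open′ y (0∈ y)
   in a * b , *-pos 0<a 0<b , a , b , 0<a , 0<b , xa , yb , refl)
  (let (u , ¬xu) = bounded x; (v , ¬yv) = bounded y
   in u * v , λ { _ (a , b , 0<a , 0<b , xa , yb , refl) →
        *-mono-≤⁺ (<⇒≤ 0<b) (<⇒≤ (∋⇒< x (0∈ x) ¬xu))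
                  (<⇒≤ (∋⇒< x xa ¬xu)) (<⇒≤ (∋⇒< y yb ¬yv)) })

private
  */-cancel : ∀ a s .{{_ : NonZero s}} → a * 1/ s * s ≡ a
  */-cancel a s = trans (*-assoc a (1/ s) s) (trans (cong (a *_) (*-inverseˡ s)) (*-identityʳ a))

-- x / y = sup { t | t s < x for some rational s ≥ y }
_/ᵣ_ : ℝ⁺ → ℝ⁺ → ℝ⁺
x /ᵣ y = sup (λ t → ∃[ s ] ¬ (y ∋ s) × x ∋ t * s) inhab bdd
  where
  inhab : ∃ λ t → 0ℚ < t × ∃[ s ] ¬ (y ∋ s) × x ∋ t * s
  inhab with bounded y | open′ x (0∈ x)
  ... | s , ¬ys | a , 0<a , xa = a * 1/ s , *-pos 0<a 0<1/s , s , ¬ys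
      , subst (x ∋_) (sym (*/-cancel a s)) xa
    where
    instance
      pos-s : Positive s
      pos-s = positive (∋⇒< y (0∈ y) ¬ys)
      nz-s : NonZero s
      nz-s = pos⇒nonZero s
    0<1/s : 0ℚ < 1/ s
    0<1/s = positive⁻¹ (1/ s) {{1/pos⇒pos s}}

  bdd : ∃ λ w → ∀ t → (∃[ s ] ¬ (y ∋ s) × x ∋ t * s) → t ≤ w
  bdd with open′ y (0∈ y) | bounded x
  ... | b , 0<b , yb | u , ¬xu = u * 1/ b , λ t (s , ¬ys , xts) → ≮⇒≥ λ w<t →
      let 0<w = *-pos (∋⇒< x (0∈ x) ¬xu) 0<1/b
          tb≤ts = *-monoˡ-≤-nonNeg t {{nonNegative (<⇒≤ (<-trans 0<w w<t))}}
                    (<⇒≤ (∋⇒< y yb ¬ys))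
          u<tb = subst (_< t * b) (*/-cancel u b) (*-monoˡ-<-pos b w<t)
      in <-irrefl refl (<-trans (<-≤-trans u<tb tb≤ts) (∋⇒< x xts ¬xu))
    where
    instance
      pos-b : Positive b
      pos-b = positive 0<b
      nz-b : NonZero b
      nz-b = pos⇒nonZero b
    0<1/b : 0ℚ < 1/ b
    0<1/b = positive⁻¹ (1/ b) {{1/pos⇒pos b}}

-- For t ≥ 0 and a rational s = p/q > 0 this says t < x ^ (p/q): some positive
-- r < x has t ^ q ≤ r ^ p.
_≺_^_ : ℚ → ℝ⁺ → ℚ → Set
t ≺ x ^ s = ∃[ r ] 0ℚ < r × x ∋ r × t ^ℚ ↧ₙ s ≤ r ^ℚ ℤ.∣ ↥ s ∣

-- x ^ y = sup { min (x ^ s₁) (x ^ s₂) | s₁ < y ≤ s₂ rational, 0 < s₁ }: the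
-- minimum is x ^ s₁ when x ≥ 1, and x ^ s₂ when x ≤ 1.
_^ᵣ_ : ℝ⁺ → ℝ⁺ → ℝ⁺
x ^ᵣ y = sup S inhab bdd
  where
  S : ℚ → Set
  S t = 0ℚ ≤ t × ∃[ s₁ ] ∃[ s₂ ] 0ℚ < s₁ × y ∋ s₁ × ¬ (y ∋ s₂) × t ≺ x ^ s₁ × t ≺ x ^ s₂

  small : ∃ λ r → 0ℚ < r × r ≤ 1ℚ × x ∋ r
  small with open′ x (0∈ x)
  ... | r , 0<r , xr with r ≤? 1ℚ
  ...   | yes r≤1 = r , 0<r , r≤1 , xr
  ...   | no  r≰1 = 1ℚ , toWitness {a? = 0ℚ <? 1ℚ} _ , ≤-refl , down x (≰⇒> r≰1) xr

  inhab : ∃ λ t → 0ℚ < t × S t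
  inhab with small | open′ y (0∈ y) | bounded y
  ... | r , 0<r , r≤1 , xr | s₁ , 0<s₁ , ys₁ | s₂ , ¬ys₂ =
      t , 0<t , <⇒≤ 0<t , s₁ , s₂ , 0<s₁ , ys₁ , ¬ys₂
      , (r , 0<r , xr , le s₁ (ℕ.m≤m+n _ _))
      , (r , 0<r , xr , le s₂ (ℕ.m≤n+m _ _))
    where
    k = ℤ.∣ ↥ s₁ ∣ ℕ.+ ℤ.∣ ↥ s₂ ∣
    t = r ^ℚ k
    0<t = ^-pos 0<r k
    le : ∀ s → ℤ.∣ ↥ s ∣ ℕ.≤ k → t ^ℚ ↧ₙ s ≤ r ^ℚ ℤ.∣ ↥ s ∣
    le s p≤k = ≤-trans
      (subst (t ^ℚ ↧ₙ s ≤_) (*-identityʳ t)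
        (^-antimonoʳ-≤ 0<t (^-≤1 0<r r≤1 k) {1} {↧ₙ s} (ℕ.s≤s ℕ.z≤n)))
      (^-antimonoʳ-≤ 0<r r≤1 p≤k)

  bdd : ∃ λ w → ∀ t → S t → t ≤ w
  bdd with bounded x | bounded y
  ... | u , ¬xu | v , ¬yv = U ^ℚ M , λ t (_ , s₁ , _ , 0<s₁ , ys₁ , _ , (r , 0<r , xr , le) , _) →
      ≮⇒≥ λ w<t → <-irrefl refl (<-≤-trans
        (^-monoˡ-< (^-pos 0<U M) w<t (ℚ.denominator-1 s₁))
        (≤-trans le (≤-trans
          (^-monoˡ-≤ 0<r (≤-trans (<⇒≤ (∋⇒< x xr ¬xu)) (p≤q⊔p 1ℚ u)) ℤ.∣ ↥ s₁ ∣)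
          (subst (U ^ℚ ℤ.∣ ↥ s₁ ∣ ≤_) (sym (^-assocʳ U M (↧ₙ s₁)))
            (^-monoʳ-≤ (p≤p⊔q 1ℚ u) (num≤ s₁ v 0<s₁ (∋⇒< y ys₁ ¬yv)))))))
    where
    U = 1ℚ ⊔ u
    M = ℤ.∣ ↥ v ∣
    0<U : 0ℚ < U
    0<U = <-≤-trans (toWitness {a? = 0ℚ <? 1ℚ} _) (p≤p⊔q 1ℚ u)
    num≤ : ∀ s v → 0ℚ < s → s < v → ℤ.∣ ↥ s ∣ ℕ.≤ ℤ.∣ ↥ v ∣ ℕ.* ↧ₙ s
    num≤ (mkℚ (+ p) q _)   (mkℚ (+ a) b _)   _ (*<* lt) =
      ℕ.≤-trans (ℕ.m≤m*n p (suc b))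
        (ℤ.drop‿+≤+ (subst₂′ (ℤ.pos-* p (suc b)) (ℤ.pos-* a (suc q)) (ℤ.<⇒≤ lt)))
      where
      subst₂′ : ∀ {i j k l} → i ≡ j → k ≡ l → j ℤ.≤ l → i ℤ.≤ k
      subst₂′ refl refl h = h
    num≤ s@(mkℚ (+ _) _ _) v@(mkℚ -[1+ _ ] _ _) 0<s s<v =
      ⊥-elim (<-asym (<-trans 0<s s<v) (negative⁻¹ v))
    num≤ s@(mkℚ -[1+ _ ] _ _) _ 0<s _ = ⊥-elim (<-asym 0<s (negative⁻¹ s))

-- q ^ i / i!
expTerm : ℚ → ℕ → ℚ
expTerm q zero    = 1ℚ
expTerm q (suc i) = expTerm q i * (q * (+ 1 / suc i))

-- Σ_{i ≤ k} q ^ i / i!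
expSum : ℚ → ℕ → ℚ
expSum q zero    = expTerm q zero
expSum q (suc k) = expSum q k + expTerm q (suc k)

private
  inv≡ : ∀ i → + 1 / suc i ≡ mkℚ (+ 1) i (1-coprimeTo (suc i))
  inv≡ i = normalize-coprime (1-coprimeTo (suc i))

  0<inv : ∀ i → 0ℚ < + 1 / suc i
  0<inv i = subst (0ℚ <_) (sym (inv≡ i)) (positive⁻¹ (mkℚ (+ 1) i _))

  inv-anti : ∀ {i j} → i ℕ.≤ j → + 1 / suc j ≤ + 1 / suc i
  inv-anti {i} {j} i≤j = subst (λ z → z ≤ + 1 / suc i) (sym (inv≡ j))
    (subst (mkℚ (+ 1) j (1-coprimeTo (suc j)) ≤_) (sym (inv≡ i))
      (*≤* (ℤ.*-monoˡ-≤-nonNeg (+ 1) (ℤ.+≤+ (ℕ.s≤s i≤j)))))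

  half+half : ∀ a → a * ½ + a * ½ ≡ a
  half+half a = trans (sym (*-distribˡ-+ a ½ ½)) (*-identityʳ a)

module _ (q : ℚ) (0<q : 0ℚ < q) where

  expTerm-pos : ∀ i → 0ℚ < expTerm q i
  expTerm-pos zero    = toWitness {a? = 0ℚ <? 1ℚ} _
  expTerm-pos (suc i) = *-pos (expTerm-pos i) (*-pos 0<q (0<inv i))

  expSum-mono : ∀ k j → expSum q k ≤ expSum q (j ℕ.+ k)
  expSum-mono k zero    = ≤-refl
  expSum-mono k (suc j) = ≤-trans (expSum-mono k j) (≤+nonNeg _ (<⇒≤ (expTerm-pos (suc (j ℕ.+ k)))))

  -- From the M-th on, each term is at most half of the preceding one.
  expSum-bound : ∀ M → q * (+ 1 / suc M) ≤ ½ → ∀ k → expSum q k ≤ expSum q M + expTerm q M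
  expSum-bound M qM≤½ k = ≤-trans (expSum-mono k M)
    (subst (λ i → expSum q i ≤ expSum q M + expTerm q M) (ℕ.+-comm k M)
      (≤-trans (≤+nonNeg _ (<⇒≤ (expTerm-pos (k ℕ.+ M)))) (go k)))
    where
    open ≤-Reasoning
    go : ∀ j → expSum q (j ℕ.+ M) + expTerm q (j ℕ.+ M) ≤ expSum q M + expTerm q M
    go zero    = ≤-refl
    go (suc j) = begin
      (s + t′) + t′             ≡⟨ +-assoc s t′ t′ ⟩
      s + (t′ + t′)             ≤⟨ +-monoʳ-≤ s (+-mono-≤ t′≤ t′≤) ⟩
      s + (t * ½ + t * ½)       ≡⟨ cong (λ z → s + z) (half+half t) ⟩
      s + t                     ≤⟨ go j ⟩
      expSum q M + expTerm q M  ∎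
      where
      s  = expSum q (j ℕ.+ M)
      t  = expTerm q (j ℕ.+ M)
      t′ = expTerm q (suc (j ℕ.+ M))
      t′≤ : t′ ≤ t * ½
      t′≤ = *-monoˡ-≤-nonNeg t {{nonNegative (<⇒≤ (expTerm-pos (j ℕ.+ M)))}}
        (≤-trans (*-monoˡ-≤-nonNeg q {{nonNegative (<⇒≤ 0<q)}} (inv-anti (ℕ.m≤n+m M j))) qM≤½)

  private
    M₀ : ∃ λ M → q * (+ 1 / suc M) ≤ ½
    M₀ = 2 ℕ.* ℤ.∣ ↥ q ∣ , subst (λ z → q * z ≤ ½) (sym (inv≡ _)) (toℚᵘ-cancel-≤
           (ℚᵘ.≤-respˡ-≃ (ℚᵘ.≃-sym (toℚᵘ-homo-* q (mkℚ (+ 1) (2 ℕ.* ℤ.∣ ↥ q ∣) _))) (core q)))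
      where
      core : ∀ q → toℚᵘ q ℚᵘ.* mkℚᵘ (+ 1) (2 ℕ.* ℤ.∣ ↥ q ∣) ℚᵘ.≤ mkℚᵘ (+ 1) 1
      core (mkℚ (+ p) d _) = *≤* (ineq p d)
        where
        ineq : ∀ p d → + p ℤ.* + 1 ℤ.* + 2 ℤ.≤ + 1 ℤ.* + (suc d ℕ.* suc (2 ℕ.* p))
        ineq p d = begin
          + p ℤ.* + 1 ℤ.* + 2                ≡⟨ cong (ℤ._* + 2) (ℤ.*-identityʳ (+ p)) ⟩
          + p ℤ.* + 2                        ≡⟨ sym (ℤ.pos-* p 2) ⟩
          + (p ℕ.* 2)                        ≤⟨ ℤ.+≤+ (ℕ.≤-trans (ℕ.≤-reflexive (ℕ.*-comm p 2))
                                                 (ℕ.≤-trans (ℕ.n≤1+n _) (ℕ.m≤m+n _ _))) ⟩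
          + (suc d ℕ.* suc (2 ℕ.* p))        ≡⟨ sym (ℤ.*-identityˡ _) ⟩
          + 1 ℤ.* + (suc d ℕ.* suc (2 ℕ.* p)) ∎
          where open ℤ.≤-Reasoning
      core (mkℚ -[1+ p ] d _) = *≤* ℤ.-≤+

  exp : ℝ⁺
  exp = sup (λ s → ∃[ k ] s ≡ expSum q k)
    (1ℚ , toWitness {a? = 0ℚ <? 1ℚ} _ , 0 , refl)
    (_ , λ { _ (k , refl) → expSum-bound (proj₁ M₀) (proj₂ M₀) k })

  exp-upper : ∀ {r} → (∀ k → expSum q k ≤ r) → ¬ (exp ∋ r)
  exp-upper S≤r (_ , (k , refl) , r<s) = <-irrefl refl (<-≤-trans r<s (S≤r k))

-- Natural logarithm of a real x > 1, as the inverse of exp: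
-- log x = sup { q | q > 0 rational, exp q < x }.
log : (x : ℝ⁺) → x ∋ 1ℚ → ℝ⁺
log x 1<x = sup (λ q → Σ (0ℚ < q) λ 0<q → exp q 0<q <ᵣ x) inhab bdd
  where
  inhab : ∃ λ q → 0ℚ < q × Σ (0ℚ < q) λ 0<q → exp q 0<q <ᵣ x
  inhab with open′ x 1<x
  ... | r , 1<r , xr = q , 0<q , 0<q , r , xr , exp-upper q 0<q (λ k →
        ≤-trans (expSum-bound q 0<q 1 q/2≤½ k) bound≤r)
    where
    open ≤-Reasoning
    d = r - 1ℚ
    0<d : 0ℚ < d
    0<d = +-monoˡ-< (- 1ℚ) 1<r
    q = 1ℚ ⊓ (d * ½)
    0<q : 0ℚ < q
    0<q with ⊓-sel 1ℚ (d * ½)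
    ... | inj₁ e = subst (0ℚ <_) (sym e) (toWitness {a? = 0ℚ <? 1ℚ} _)
    ... | inj₂ e = subst (0ℚ <_) (sym e) (*-pos 0<d (toWitness {a? = 0ℚ <? ½} _))
    q/2≤½ : q * (+ 1 / 2) ≤ ½
    q/2≤½ = *-monoʳ-≤-nonNeg ½ (p⊓q≤p 1ℚ (d * ½))
    q≡ : 1ℚ * (q * (+ 1 / 1)) ≡ q
    q≡ = trans (*-identityˡ _) (*-identityʳ q)
    bound≤r : expSum q 1 + expTerm q 1 ≤ r
    bound≤r = begin
      (1ℚ + 1ℚ * (q * (+ 1 / 1))) + 1ℚ * (q * (+ 1 / 1)) ≡⟨ cong (λ z → 1ℚ + z + z) q≡ ⟩
      (1ℚ + q) + q             ≡⟨ +-assoc 1ℚ q q ⟩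
      1ℚ + (q + q)             ≤⟨ +-monoʳ-≤ 1ℚ (+-mono-≤ (p⊓q≤q 1ℚ (d * ½)) (p⊓q≤q 1ℚ (d * ½))) ⟩
      1ℚ + (d * ½ + d * ½)     ≡⟨ cong (λ z → 1ℚ + z) (half+half d) ⟩
      1ℚ + (r - 1ℚ)            ≡⟨ +-comm 1ℚ (r - 1ℚ) ⟩
      (r - 1ℚ) + 1ℚ            ≡⟨ +-assoc r (- 1ℚ) 1ℚ ⟩
      r + 0ℚ                   ≡⟨ +-identityʳ r ⟩
      r                        ∎

  bdd : ∃ λ u → ∀ q → (Σ (0ℚ < q) λ 0<q → exp q 0<q <ᵣ x) → q ≤ u
  bdd with bounded x
  ... | u , ¬xu = u , λ q (0<q , r , xr , ¬er) → <⇒≤ (≤-<-trans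
        (≤-trans (q≤sum q) (≮⇒≥ λ r<s → ¬er (_ , (1 , refl) , r<s)))
        (∋⇒< x xr ¬xu))
    where
    q≤sum : ∀ q → q ≤ expSum q 1
    q≤sum q = subst (_≤ expSum q 1) (trans (+-identityˡ _) (trans (*-identityˡ _) (*-identityʳ q)))
      (+-monoˡ-≤ (1ℚ * (q * (+ 1 / 1))) 0≤1)

------------------------------------------------------------------------
-- log n, log log n and the exponent (m-1)/3

private
  nat-mono-≤ : ∀ {j k} → j ℕ.≤ k → + j / 1 ≤ + k / 1
  nat-mono-≤ {j} {k} j≤k = toℚᵘ-cancel-≤
    (ℚᵘ.≤-respˡ-≃ (ℚᵘ.≃-sym (toℚᵘ-fromℚᵘ (mkℚᵘ (+ j) 0)))
      (ℚᵘ.≤-respʳ-≃ (ℚᵘ.≃-sym (toℚᵘ-fromℚᵘ (mkℚᵘ (+ k) 0)))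
        (*≤* (ℤ.*-monoʳ-≤-nonNeg (+ 1) (ℤ.+≤+ j≤k)))))

module _ (n : ℕ) (3≤n : 3 ℕ.≤ n) where

  private
    <3⇒<n : ∀ {r} → r < + 3 / 1 → r < + n / 1
    <3⇒<n r<3 = <-≤-trans r<3 (nat-mono-≤ 3≤n)

  nℝ : ℝ⁺
  nℝ = fromℚ (+ n / 1) (<3⇒<n (toWitness {a? = 0ℚ <? + 3 / 1} _))

  logn : ℝ⁺
  logn = log nℝ (<3⇒<n (toWitness {a? = 1ℚ <? + 3 / 1} _))

  -- since e ^ 1.05 < 2.99 < 3
  1<logn : logn ∋ 1ℚ
  1<logn = q , (0<q , + 299 / 100 , <3⇒<n (toWitness {a? = + 299 / 100 <? + 3 / 1} _)
             , exp-upper q 0<q λ k → ≤-trans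
                 (expSum-bound q 0<q 3 (toWitness {a? = q * (+ 1 / 4) ≤? ½} _) k)
                 (toWitness {a? = expSum q 3 + expTerm q 3 ≤? + 299 / 100} _))
           , toWitness {a? = 1ℚ <? q} _
    where
    q = + 21 / 20
    0<q : 0ℚ < q
    0<q = toWitness {a? = 0ℚ <? q} _

  loglogn : ℝ⁺
  loglogn = log logn 1<logn

[_-1]/3 : ∀ m → 1 ℕ.< m → ℝ⁺
[ m -1]/3 1<m = fromℚ (+ (m ℕ.∸ 1) / 3) (positiveExponent m 1<m)
  where
  positiveExponent : ∀ m → 1 ℕ.< m → 0ℚ < + (m ℕ.∸ 1) / 3
  positiveExponent (suc zero) (ℕ.s≤s ())
  positiveExponent (suc (suc k)) _ = positive⁻¹ _ {{normalize-pos (suc k) 3}}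

{-# OPTIONS --safe #-}
module Submission where

-- Call a 2-colouring of the vertices closed if no edge joins two colours. As
-- long as a colouring of G₁ is closed, each colour class of size A has total
-- degree 2A, so the next edge keeps it closed with a probability that depends
-- on the class sizes only. Hence a colouring of G_m^n with classes of size k
-- and l is closed with probability exactly
-- (2mk-1)!! (2ml-1)!! / (2mn-1)!!, which for m ≥ 2 is at most C(n,k)⁻². A
-- disconnected graph has a closed colouring using both colours, and the sum of
-- C(n,k)⁻² over these is O(1/n). As log n = O(n^δ) for every δ > 0 and
-- log log n is bounded away from 0, the right-hand side is at least a constant
-- times 1/n.

open import Defs

-- There are C(n,k) colourings with class sizes k and n-k, so the square leaves the sum of 1/C(n,k);
-- with the first power alone every k would contribute 1. This is where m ≥ 2 enters: each block of
-- merged vertices provides at least two factors of size at most (k+1)/(n+1). A class of size A has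
-- degree 2A because every vertex creates exactly one edge, and in a closed colouring both ends of
-- that edge lie in the class of its creator.
--
-- Colourings, weights and sums over colourings are built by adding the newest vertex, as the graph
-- is, and probabilities are compared after multiplication by (2mn-1)!!, so the counting stays in
-- the natural numbers. Binomial coefficients appear only as k! l! against n!, and a new vertex
-- multiplies k! l! by k+1 or l+1.
--
-- Reals are lower cuts, so it is enough to exhibit rationals below the right-hand side. The real
-- exponents can be replaced by larger natural ones, because log n is below every power of n and the
-- order of that power may be chosen last.

module Counting where

  open import Data.Bool.Base using (Bool; true; false)
  open import Data.Nat.Base
  open import Data.Nat.Properties
  open import Data.Nat.Tactic.RingSolver using (solve-∀)
  open import Data.Product.Base using (_,_)
  open import Data.Vec.Base using (Vec; []; _∷_; _++_; map; concat; replicate)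
  open import Function.Base using (case_of_)
  open import Relation.Binary.PropositionalEquality
    using (_≡_; refl; sym; trans; cong; cong₂; subst; module ≡-Reasoning)

  -- Two-colourings and sums over all of them

  agree : Bool → Bool → ℕ
  agree true  true  = 1
  agree false false = 1
  agree _     _     = 0

  count : ∀ {n} → Bool → Vec Bool n → ℕ
  count b []      = 0
  count b (x ∷ c) = agree x b + count b c

  agree-refl : ∀ b → agree b b ≡ 1
  agree-refl true  = refl
  agree-refl false = refl

  count-total : ∀ {n} (c : Vec Bool n) → count true c + count false c ≡ n
  count-total []          = refl
  count-total (true  ∷ c) = cong suc (count-total c)
  count-total (false ∷ c) = trans (+-suc (count true c) (count false c)) (cong suc (count-total c))

  count≤n : ∀ {n} b (c : Vec Bool n) → count b c ≤ n
  count≤n true  c = subst (count true c ≤_) (count-total c) (m≤m+n _ _)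
  count≤n false c = subst (count false c ≤_) (count-total c) (m≤n+m _ (count true c))

  count-++ : ∀ {i j} b (c : Vec Bool i) (d : Vec Bool j) → count b (c ++ d) ≡ count b c + count b d
  count-++ b []      d = refl
  count-++ b (x ∷ c) d = trans (cong (agree x b +_) (count-++ b c d)) (sym (+-assoc (agree x b) _ _))

  count-replicate : ∀ i x b → count b (replicate i x) ≡ i * agree x b
  count-replicate zero    x b = refl
  count-replicate (suc i) x b = cong (agree x b +_) (count-replicate i x b)

  -- The two extensions of a cut are added inside the sum, so a recursion in `n` reduces to an
  -- inequality about a single cut and its two extensions.
  cutSum : ∀ n → (Vec Bool n → ℕ) → ℕ
  cutSum zero    F = F []
  cutSum (suc n) F = cutSum n (λ c → F (true ∷ c) + F (false ∷ c))

  cutSum-mono : ∀ n {F G} → (∀ c → F c ≤ G c) → cutSum n F ≤ cutSum n G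
  cutSum-mono zero    F≤G = F≤G []
  cutSum-mono (suc n) F≤G = cutSum-mono n (λ c → +-mono-≤ (F≤G (true ∷ c)) (F≤G (false ∷ c)))

  cutSum-cong : ∀ n {F G} → (∀ c → F c ≡ G c) → cutSum n F ≡ cutSum n G
  cutSum-cong zero    F≡G = F≡G []
  cutSum-cong (suc n) F≡G = cutSum-cong n (λ c → cong₂ _+_ (F≡G (true ∷ c)) (F≡G (false ∷ c)))

  cutSum-+ : ∀ n F G → cutSum n (λ c → F c + G c) ≡ cutSum n F + cutSum n G
  cutSum-+ zero    F G = refl
  cutSum-+ (suc n) F G = trans
    (cutSum-cong n (λ c → shuffle (F (true ∷ c)) (G (true ∷ c)) (F (false ∷ c)) (G (false ∷ c))))
    (cutSum-+ n _ _)
    where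
    shuffle : ∀ w x y z → (w + x) + (y + z) ≡ (w + y) + (x + z)
    shuffle = solve-∀

  cutSum-*ˡ : ∀ n x F → cutSum n (λ c → x * F c) ≡ x * cutSum n F
  cutSum-*ˡ zero    x F = refl
  cutSum-*ˡ (suc n) x F = trans
    (cutSum-cong n (λ c → sym (*-distribˡ-+ x (F (true ∷ c)) (F (false ∷ c)))))
    (cutSum-*ˡ n x _)

  term≤cutSum : ∀ n F c → F c ≤ cutSum n F
  term≤cutSum zero    F []          = ≤-refl
  term≤cutSum (suc n) F (true  ∷ c) = ≤-trans (m≤m+n _ _) (term≤cutSum n _ c)
  term≤cutSum (suc n) F (false ∷ c) = ≤-trans (m≤n+m _ (F (true ∷ c))) (term≤cutSum n _ c)

  -- Odd double factorials against binomial coefficients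

  -- The double factorial (2t-1)!!, the product of the normalisations of the first `t` steps of the
  -- process.
  oddProduct : ℕ → ℕ
  oddProduct zero    = 1
  oddProduct (suc t) = suc (2 * t) * oddProduct t

  -- Equals (2k-1)!! (2l-1)!! for sides of sizes k and l, in whatever order the colours come.
  closedWeight : ∀ {n} → Vec Bool n → ℕ
  closedWeight []      = 1
  closedWeight (b ∷ c) = suc (2 * count b c) * closedWeight c

  -- k! l!, where k and l are the sizes of the two sides.
  sideFactorials : ∀ {n} → Vec Bool n → ℕ
  sideFactorials []      = 1
  sideFactorials (b ∷ c) = suc (count b c) * sideFactorials c

  refine : ∀ {n} m → Vec Bool n → Vec Bool (n * m)
  refine m c = concat (map (replicate m) c)

  count-refine : ∀ {n} m b (c : Vec Bool n) → count b (refine m c) ≡ m * count b c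
  count-refine m b []      = sym (*-zeroʳ m)
  count-refine m b (x ∷ c) = begin
    count b (replicate m x ++ refine m c)         ≡⟨ count-++ b (replicate m x) (refine m c) ⟩
    count b (replicate m x) + count b (refine m c) ≡⟨ cong₂ _+_ (count-replicate m x b) (count-refine m b c) ⟩
    m * agree x b + m * count b c                 ≡⟨ sym (*-distribˡ-+ m (agree x b) (count b c)) ⟩
    m * (agree x b + count b c)                   ∎
    where open ≡-Reasoning

  oddProduct≢0 : ∀ t → NonZero (oddProduct t)
  oddProduct≢0 zero    = _
  oddProduct≢0 (suc t) = m*n≢0 (suc (2 * t)) (oddProduct t) {{_}} {{oddProduct≢0 t}}

  -- The right side exceeds the left by (n-k)(2(m-i)-1), which is the term added in the proof, with
  -- d = n-k and e = m-i-1.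
  oddRatio : ∀ {m i k n} → k ≤ n → i < m →
             suc (2 * (i + m * k)) * suc n ≤ suc k * suc (2 * (i + n * m))
  oddRatio {m} {i} {k} {n} k≤n i<m
    with d , refl ← m≤n⇒∃[o]m+o≡n k≤n | e , refl ← m≤n⇒∃[o]m+o≡n i<m =
    ≤-trans (m≤m+n _ (d + 2 * (e * d))) (≤-reflexive (identity i k d e))
    where
    identity : ∀ i k d e →
      suc (2 * (i + (suc i + e) * k)) * suc (k + d) + (d + 2 * (e * d)) ≡
      suc k * suc (2 * (i + (k + d) * (suc i + e)))
    identity = solve-∀

  module _ {m k n} (k≤n : k ≤ n) (b : Bool) (c : Vec Bool (n * m)) (count≡ : count b c ≡ m * k) where

    private
      W : ℕ → ℕ
      W i = closedWeight (replicate i b ++ c)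

      D : ℕ → ℕ
      D i = oddProduct (i + n * m)

      W-suc : ∀ i → W (suc i) ≡ suc (2 * (i + m * k)) * W i
      W-suc i = cong (λ x → suc (2 * x) * W i) (begin
        count b (replicate i b ++ c)        ≡⟨ count-++ b (replicate i b) c ⟩
        count b (replicate i b) + count b c ≡⟨ cong₂ _+_ (count-replicate i b b) count≡ ⟩
        i * agree b b + m * k               ≡⟨ cong (λ x → i * x + m * k) (agree-refl b) ⟩
        i * 1 + m * k                       ≡⟨ cong (_+ m * k) (*-identityʳ i) ⟩
        i + m * k                           ∎)
        where open ≡-Reasoning

      step≤1 : ∀ i x y → W i * x ≤ y * D i → W (suc i) * x ≤ y * D (suc i)
      step≤1 i x y le = begin
        W (suc i) * x                         ≡⟨ cong (_* x) (W-suc i) ⟩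
        suc (2 * (i + m * k)) * W i * x       ≡⟨ *-assoc (suc (2 * (i + m * k))) (W i) x ⟩
        suc (2 * (i + m * k)) * (W i * x)
          ≤⟨ *-mono-≤ (s≤s (*-monoʳ-≤ 2 (+-monoʳ-≤ i (≤-trans (*-monoʳ-≤ m k≤n) (≤-reflexive (*-comm m n)))))) le ⟩
        suc (2 * (i + n * m)) * (y * D i)     ≡⟨ swap (suc (2 * (i + n * m))) y (D i) ⟩
        y * D (suc i)                         ∎
        where
        open ≤-Reasoning
        swap : ∀ p q r → p * (q * r) ≡ q * (p * r)
        swap = solve-∀

      step : ∀ i x y → i < m → W i * x ≤ y * D i → W (suc i) * (suc n * x) ≤ suc k * y * D (suc i)
      step i x y i<m le = begin
        W (suc i) * (suc n * x)                     ≡⟨ cong (_* (suc n * x)) (W-suc i) ⟩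
        suc (2 * (i + m * k)) * W i * (suc n * x)   ≡⟨ swap (suc (2 * (i + m * k))) (W i) (suc n) x ⟩
        suc (2 * (i + m * k)) * suc n * (W i * x)   ≤⟨ *-mono-≤ (oddRatio {m} k≤n i<m) le ⟩
        suc k * suc (2 * (i + n * m)) * (y * D i)   ≡⟨ swap (suc k) (suc (2 * (i + n * m))) y (D i) ⟩
        suc k * y * D (suc i)                       ∎
        where
        open ≤-Reasoning
        swap : ∀ p q r s → p * q * (r * s) ≡ p * r * (q * s)
        swap = solve-∀

    -- Relative to the double factorial, each vertex of the new block contributes a factor of at
    -- most (k+1)/(n+1). The first two keep this bound (`step`), the others are bounded by 1
    -- (`step≤1`), so the block contributes at most ((k+1)/(n+1))².
    block-bound : ∀ i → 2 + i ≤ m →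
      closedWeight (replicate (2 + i) b ++ c) * (suc n * (suc n * oddProduct (n * m))) ≤
      suc k * (suc k * closedWeight c) * oddProduct (2 + i + n * m)
    block-bound zero    2≤m = step 1 (suc n * D 0) (suc k * W 0) 2≤m
      (step 0 (D 0) (W 0) (≤-trans (n≤1+n 1) 2≤m) ≤-refl)
    block-bound (suc i) i≤m = step≤1 (2 + i) (suc n * (suc n * D 0)) (suc k * (suc k * W 0))
      (block-bound i (≤-trans (n≤1+n _) i≤m))

  -- In terms of quotients: a cut is closed with probability at most C(n,k)⁻².
  closedWeight≤ : ∀ {n} m (c : Vec Bool n) →
    closedWeight (refine (2 + m) c) * (n ! * n !) ≤
    sideFactorials c * sideFactorials c * oddProduct (n * (2 + m))
  closedWeight≤ m []      = ≤-refl
  closedWeight≤ {suc n} m (b ∷ c) = *-cancelʳ-≤ _ _ (D 0) {{oddProduct≢0 (n * (2 + m))}} (begin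
    W m * ((suc n * n !) * (suc n * n !)) * D 0          ≡⟨ move (W m) (suc n) (n !) (D 0) ⟩
    W m * (suc n * (suc n * D 0)) * (n ! * n !)
      ≤⟨ *-monoˡ-≤ (n ! * n !) (block-bound (count≤n b c) b (refine M c) (count-refine M b c) m ≤-refl) ⟩
    suc k * (suc k * W₀) * D M * (n ! * n !)             ≡⟨ move′ (suc k) W₀ (D M) (n !) ⟩
    suc k * suc k * D M * (W₀ * (n ! * n !))
      ≤⟨ *-monoʳ-≤ (suc k * suc k * D M) (closedWeight≤ m c) ⟩
    suc k * suc k * D M * (u * u * D 0)                  ≡⟨ move″ (suc k) (D M) u (D 0) ⟩
    suc k * u * (suc k * u) * D M * D 0                  ∎)
    where
    open ≤-Reasoning
    M = 2 + m
    k = count b c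
    u = sideFactorials c
    W₀ = closedWeight (refine M c)
    W : ℕ → ℕ
    W i = closedWeight (replicate (2 + i) b ++ refine M c)
    D : ℕ → ℕ
    D i = oddProduct (i + n * M)
    move : ∀ w s f d → w * ((s * f) * (s * f)) * d ≡ w * (s * (s * d)) * (f * f)
    move = solve-∀
    move′ : ∀ s w d f → s * (s * w) * d * (f * f) ≡ s * s * d * (w * (f * f))
    move′ = solve-∀
    move″ : ∀ s d u e → s * s * d * (u * u * e) ≡ s * u * (s * u) * d * e
    move″ = solve-∀

  -- The sum over cuts that use both colours

  proper improper : ℕ → ℕ → ℕ
  proper (suc _) (suc _) = 1
  proper _       _       = 0
  improper (suc _) (suc _) = 0
  improper _       _       = 1

  isProper isImproper : ∀ {n} → Vec Bool n → ℕ
  isProper   c = proper   (count true c) (count false c)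
  isImproper c = improper (count true c) (count false c)

  properWeight improperWeight : ∀ {n} → Vec Bool n → ℕ
  properWeight   c = isProper   c * (sideFactorials c * sideFactorials c)
  improperWeight c = isImproper c * (sideFactorials c * sideFactorials c)

  properSum improperSum : ℕ → ℕ
  properSum   n = cutSum n properWeight
  improperSum n = cutSum n improperWeight

  -- For k, l ≥ 1 one has (k+1)² + (l+1)² = n² + 4 - 2(k-1)(l-1), so n² + 4 is attained when a class
  -- is a single vertex. A nonempty one-coloured cut has one proper extension, whose new class has
  -- size 1 and brings the factor 1.
  properStep : ∀ {n} k l u → k + l ≡ n →
    proper (suc k) l * ((suc k * u) * (suc k * u)) + proper k (suc l) * ((suc l * u) * (suc l * u)) ≤
    (n * n + 4) * (proper k l * (u * u)) + improper k l * (u * u)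
  properStep zero    zero    u refl = z≤n
  properStep zero    (suc l) u refl = ≤-trans (≤-reflexive (identity u)) (m≤n+m _ ((suc l * suc l + 4) * 0))
    where
    identity : ∀ u → 1 * (1 * u * (1 * u)) + 0 ≡ 1 * (u * u)
    identity = solve-∀
  properStep (suc k) zero    u refl = ≤-trans (≤-reflexive (identity u)) (m≤n+m _ (((suc k + 0) * (suc k + 0) + 4) * 0))
    where
    identity : ∀ u → 1 * (1 * u * (1 * u)) ≡ 1 * (u * u)
    identity = solve-∀
  properStep (suc k) (suc l) u refl = ≤-trans (m≤m+n _ (2 * (k * l) * (u * u))) (≤-reflexive (identity k l u))
    where
    identity : ∀ k l u →
      1 * (((2 + k) * u) * ((2 + k) * u)) + 1 * (((2 + l) * u) * ((2 + l) * u)) + 2 * (k * l) * (u * u)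
      ≡ ((suc k + suc l) * (suc k + suc l) + 4) * (1 * (u * u)) + 0
    identity = solve-∀

  -- A nonempty one-coloured cut stays one-coloured in one way only. The empty cut has two such
  -- extensions, hence `suc n` in the hypothesis and the 2 in `improperSum≤`.
  improperStep : ∀ {n} k l u → k + l ≡ suc n →
    improper (suc k) l * ((suc k * u) * (suc k * u)) + improper k (suc l) * ((suc l * u) * (suc l * u)) ≤
    (2 + n) * (2 + n) * (improper k l * (u * u))
  improperStep zero    (suc l) u refl = ≤-reflexive (identity l u)
    where
    identity : ∀ l u → 1 * (((2 + l) * u) * ((2 + l) * u)) ≡ (2 + l) * (2 + l) * (1 * (u * u))
    identity = solve-∀
  improperStep (suc k) zero    u refl = ≤-reflexive (identity k u)
    where
    identity : ∀ k u → 1 * (((2 + k) * u) * ((2 + k) * u)) + 0 ≡ (2 + (k + 0)) * (2 + (k + 0)) * (1 * (u * u))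
    identity = solve-∀
  improperStep (suc k) (suc l) u refl = z≤n

  improperSum≤ : ∀ n → improperSum (suc n) ≤ 2 * (suc n ! * suc n !)
  improperSum≤ zero    = ≤-refl
  improperSum≤ (suc n) = begin
    improperSum (2 + n)
      ≤⟨ cutSum-mono (suc n) (λ c → improperStep (count true c) (count false c) (sideFactorials c) (count-total c)) ⟩
    cutSum (suc n) (λ c → (2 + n) * (2 + n) * improperWeight c)
      ≡⟨ cutSum-*ˡ (suc n) ((2 + n) * (2 + n)) improperWeight ⟩
    (2 + n) * (2 + n) * improperSum (suc n)
      ≤⟨ *-monoʳ-≤ ((2 + n) * (2 + n)) (improperSum≤ n) ⟩
    (2 + n) * (2 + n) * (2 * (suc n ! * suc n !))            ≡⟨ move (2 + n) (suc n !) ⟩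
    2 * ((2 + n) ! * (2 + n) !)                              ∎
    where
    open ≤-Reasoning
    move : ∀ s f → s * s * (2 * (f * f)) ≡ 2 * ((s * f) * (s * f))
    move = solve-∀

  properSum-suc : ∀ n → properSum (2 + n) ≤ (suc n * suc n + 4) * properSum (suc n) + 2 * (suc n ! * suc n !)
  properSum-suc n = begin
    properSum (2 + n)
      ≤⟨ cutSum-mono (suc n) (λ c → properStep (count true c) (count false c) (sideFactorials c) (count-total c)) ⟩
    cutSum (suc n) (λ c → (suc n * suc n + 4) * properWeight c + improperWeight c)
      ≡⟨ cutSum-+ (suc n) (λ c → (suc n * suc n + 4) * properWeight c) improperWeight ⟩
    cutSum (suc n) (λ c → (suc n * suc n + 4) * properWeight c) + improperSum (suc n)
      ≤⟨ +-mono-≤ (≤-reflexive (cutSum-*ˡ (suc n) (suc n * suc n + 4) properWeight)) (improperSum≤ n) ⟩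
    (suc n * suc n + 4) * properSum (suc n) + 2 * (suc n ! * suc n !) ∎
    where open ≤-Reasoning

  -- The 4 is what the induction step asks for from n = 8 on; the second summand settles the base
  -- case `n₀`, as (n₀!)² ≥ 1.
  properConstant : ℕ → ℕ
  properConstant n₀ = 4 + n₀ * properSum n₀

  private
    -- With n = 8 + d and A = 4 + a the claim reduces to (n²+4)A + 2n ≤ n(n+1)A, that is, to 2n ≤
    -- A(n-4). For A = 4 this holds exactly from n = 8 on; in general the surplus is 2d + 4a + da.
    recursion : ∀ S S′ f d a → (8 + d) * S ≤ (4 + a) * f →
      S′ ≤ ((8 + d) * (8 + d) + 4) * S + 2 * f →
      (9 + d) * S′ ≤ (4 + a) * ((9 + d) * (9 + d) * f)
    recursion S S′ f d a hyp le = *-cancelˡ-≤ (8 + d) (begin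
      (8 + d) * ((9 + d) * S′)
        ≤⟨ *-monoʳ-≤ (8 + d) (*-monoʳ-≤ (9 + d) le) ⟩
      (8 + d) * ((9 + d) * (((8 + d) * (8 + d) + 4) * S + 2 * f))
        ≡⟨ before (8 + d) S f ⟩
      (9 + d) * (((8 + d) * (8 + d) + 4) * ((8 + d) * S) + (8 + d) * 2 * f)
        ≤⟨ *-monoʳ-≤ (9 + d) (+-monoˡ-≤ _ (*-monoʳ-≤ ((8 + d) * (8 + d) + 4) hyp)) ⟩
      (9 + d) * (((8 + d) * (8 + d) + 4) * ((4 + a) * f) + (8 + d) * 2 * f)
        ≤⟨ m≤m+n _ ((9 + d) * (2 * d + 4 * a + d * a) * f) ⟩
      (9 + d) * (((8 + d) * (8 + d) + 4) * ((4 + a) * f) + (8 + d) * 2 * f) + (9 + d) * (2 * d + 4 * a + d * a) * f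
        ≡⟨ after d a f ⟩
      (8 + d) * ((4 + a) * ((9 + d) * (9 + d) * f)) ∎)
      where
      open ≤-Reasoning
      before : ∀ n S f → n * (suc n * ((n * n + 4) * S + 2 * f)) ≡ suc n * ((n * n + 4) * (n * S) + n * 2 * f)
      before = solve-∀
      after : ∀ d a f →
        (9 + d) * (((8 + d) * (8 + d) + 4) * ((4 + a) * f) + (8 + d) * 2 * f) + (9 + d) * (2 * d + 4 * a + d * a) * f
        ≡ (8 + d) * ((4 + a) * ((9 + d) * (9 + d) * f))
      after = solve-∀

    recursion′ : ∀ S S′ f n a → 8 ≤ n → n * S ≤ (4 + a) * f →
      S′ ≤ (n * n + 4) * S + 2 * f → suc n * S′ ≤ (4 + a) * (suc n * suc n * f)
    recursion′ S S′ f n a 8≤n with d , refl ← m≤n⇒∃[o]m+o≡n 8≤n = recursion S S′ f d a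

  -- Σ C(n,k)⁻¹ over 0 < k < n is O(1/n).
  properSum≤ : ∀ {n₀} → 8 ≤ n₀ → ∀ {n} → n₀ ≤′ n → n * properSum n ≤ properConstant n₀ * (n ! * n !)
  properSum≤ {n₀} _ ≤′-refl = ≤-trans (m≤n+m (n₀ * properSum n₀) 4)
    (m≤m*n (properConstant n₀) (n₀ ! * n₀ !) {{m*n≢0 (n₀ !) (n₀ !) {{n₀ !≢0}} {{n₀ !≢0}}}})
  properSum≤ {n₀} 8≤n₀ {suc zero} (≤′-step n₀≤n) = case ≤-trans 8≤n₀ (≤′⇒≤ n₀≤n) of λ ()
  properSum≤ {n₀} 8≤n₀ {suc n@(suc n-1)} (≤′-step n₀≤n) =
    ≤-trans (recursion′ (properSum n) (properSum (suc n)) (n ! * n !) n (n₀ * properSum n₀)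
        (≤-trans 8≤n₀ (≤′⇒≤ n₀≤n)) (properSum≤ 8≤n₀ n₀≤n) (properSum-suc n-1))
      (≤-reflexive (cong (properConstant n₀ *_) (move (suc n) (n !))))
    where
    move : ∀ s f → s * s * (f * f) ≡ (s * f) * (s * f)
    move = solve-∀

  closedSum≤ : ∀ m {n₀ n} → 8 ≤ n₀ → n₀ ≤ n →
    n * cutSum n (λ c → isProper c * closedWeight (refine (2 + m) c)) ≤ properConstant n₀ * oddProduct (n * (2 + m))
  closedSum≤ m {n₀} {n} 8≤n₀ n₀≤n = *-cancelʳ-≤ _ _ F (begin
    n * cutSum n E * F                        ≡⟨ *-assoc n _ F ⟩
    n * (cutSum n E * F)
      ≡⟨ cong (n *_) (trans (*-comm (cutSum n E) F) (sym (cutSum-*ˡ n F E))) ⟩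
    n * cutSum n (λ c → F * E c)              ≤⟨ *-monoʳ-≤ n (cutSum-mono n pointwise) ⟩
    n * cutSum n (λ c → D * properWeight c)   ≡⟨ cong (n *_) (cutSum-*ˡ n D properWeight) ⟩
    n * (D * properSum n)                     ≡⟨ swap n D (properSum n) ⟩
    D * (n * properSum n)                     ≤⟨ *-monoʳ-≤ D (properSum≤ 8≤n₀ (≤⇒≤′ n₀≤n)) ⟩
    D * (properConstant n₀ * F)               ≡⟨ swap′ D (properConstant n₀) F ⟩
    properConstant n₀ * D * F                 ∎)
    where
    open ≤-Reasoning
    F = n ! * n !
    D = oddProduct (n * (2 + m))
    E : Vec Bool n → ℕ
    E c = isProper c * closedWeight (refine (2 + m) c)
    instance
      F≢0 : NonZero F
      F≢0 = m*n≢0 (n !) (n !) {{n !≢0}} {{n !≢0}}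
    swap : ∀ p q r → p * (q * r) ≡ q * (p * r)
    swap = solve-∀
    swap′ : ∀ p q r → p * (q * r) ≡ q * p * r
    swap′ = solve-∀
    pointwise : ∀ c → F * E c ≤ D * properWeight c
    pointwise c = begin
      F * (isProper c * closedWeight (refine (2 + m) c))      ≡⟨ left F (isProper c) _ ⟩
      isProper c * (closedWeight (refine (2 + m) c) * F)      ≤⟨ *-monoʳ-≤ (isProper c) (closedWeight≤ m c) ⟩
      isProper c * (sideFactorials c * sideFactorials c * D)  ≡⟨ right (isProper c) _ D ⟩
      D * properWeight c                                      ∎
      where
      left : ∀ p q r → p * (q * r) ≡ q * (r * p)
      left = solve-∀
      right : ∀ p q r → p * (q * r) ≡ r * (p * q)
      right = solve-∀

-- Natural numbers and their reciprocals among the rationals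

module Embedding where

  open import Data.Integer.Base as ℤ using (+_)
  import Data.Integer.Properties as ℤ
  open import Data.Nat.Base as ℕ using (ℕ; zero; suc)
  import Data.Nat.Properties as ℕ
  open import Data.Rational.Base
  open import Data.Rational.Properties
  open import Data.Rational.Unnormalised.Base as ℚᵘ using (mkℚᵘ; *≤*; *≡*)
  import Data.Rational.Unnormalised.Properties as ℚᵘ
  open import Relation.Binary.PropositionalEquality using (_≡_; refl; sym; trans; cong; cong₂)

  ι : ℕ → ℚ
  ι n = + n / 1

  inv : ℕ → ℚ
  inv d = + 1 / suc d

  private
    toℚᵘ-/ : ∀ i d → toℚᵘ (i / suc d) ℚᵘ.≃ mkℚᵘ i d
    toℚᵘ-/ i d = toℚᵘ-fromℚᵘ (mkℚᵘ i d)

    /-homo-* : ∀ i j d e → i / suc d * (j / suc e) ≡ (i ℤ.* j) / (suc d ℕ.* suc e)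
    /-homo-* i j d e = toℚᵘ-injective (ℚᵘ.≃-trans (toℚᵘ-homo-* (i / suc d) (j / suc e))
      (ℚᵘ.≃-trans (ℚᵘ.*-cong (toℚᵘ-/ i d) (toℚᵘ-/ j e))
        (ℚᵘ.≃-sym (toℚᵘ-/ (i ℤ.* j) (e ℕ.+ d ℕ.* suc e)))))

  ι-+ : ∀ a b → ι (a ℕ.+ b) ≡ ι a + ι b
  ι-+ a b = toℚᵘ-injective (ℚᵘ.≃-trans (toℚᵘ-/ (+ (a ℕ.+ b)) 0)
    (ℚᵘ.≃-trans (*≡* (cong (ℤ._* + 1) (sym (cong₂ ℤ._+_ (ℤ.*-identityʳ (+ a)) (ℤ.*-identityʳ (+ b))))))
      (ℚᵘ.≃-sym (ℚᵘ.≃-trans (toℚᵘ-homo-+ (ι a) (ι b)) (ℚᵘ.+-cong (toℚᵘ-/ (+ a) 0) (toℚᵘ-/ (+ b) 0))))))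

  ι-* : ∀ a b → ι (a ℕ.* b) ≡ ι a * ι b
  ι-* a b = trans (cong (_/ 1) (ℤ.pos-* a b)) (sym (/-homo-* (+ a) (+ b) 0 0))

  ι-mono-≤ : ∀ {a b} → a ℕ.≤ b → ι a ≤ ι b
  ι-mono-≤ {a} {b} a≤b = toℚᵘ-cancel-≤
    (ℚᵘ.≤-respˡ-≃ (ℚᵘ.≃-sym (toℚᵘ-/ (+ a) 0))
      (ℚᵘ.≤-respʳ-≃ (ℚᵘ.≃-sym (toℚᵘ-/ (+ b) 0))
        (*≤* (ℤ.*-monoʳ-≤-nonNeg (+ 1) (ℤ.+≤+ a≤b)))))

  0≤ι : ∀ a → 0ℚ ≤ ι a
  0≤ι a = ι-mono-≤ {0} {a} ℕ.z≤n

  0<ι : ∀ a → .{{ℕ.NonZero a}} → 0ℚ < ι a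
  0<ι a = positive⁻¹ (ι a) {{normalize-pos a 1}}

  0<inv : ∀ d → 0ℚ < inv d
  0<inv d = positive⁻¹ (inv d) {{normalize-pos 1 (suc d)}}

  /≡ι*inv : ∀ a d → + a / suc d ≡ ι a * inv d
  /≡ι*inv a d = trans (/-cong (sym (ℤ.*-identityʳ (+ a))) (sym (ℕ.+-identityʳ (suc d)))) (sym (/-homo-* (+ a) (+ 1) 0 d))

  inv*ι : ∀ d → inv d * ι (suc d) ≡ 1ℚ
  inv*ι d = trans (/-homo-* (+ 1) (+ suc d) d 0) (toℚᵘ-injective
    (ℚᵘ.≃-trans (toℚᵘ-/ (+ 1 ℤ.* + suc d) (d ℕ.* 1))
      (*≡* (trans (ℤ.*-identityʳ (+ 1 ℤ.* + suc d)) (trans (ℤ.*-identityˡ (+ suc d))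
        (sym (trans (ℤ.*-identityˡ (+ suc (d ℕ.* 1))) (cong (λ x → + suc x) (ℕ.*-identityʳ d)))))))))

  ι-^ : ∀ a k → ι (a ℕ.^ k) ≡ ι a ^ℚ k
  ι-^ a zero    = refl
  ι-^ a (suc k) = trans (ι-* a (a ℕ.^ k)) (cong (ι a *_) (ι-^ a k))

-- The expected number of closed cuts

module Probability where

  open Counting
  open Embedding
  open import Data.Bool.Base using (Bool; true; false; if_then_else_)
  open import Data.Fin.Base using (Fin; zero; suc; inject₁; fromℕ; opposite; quotient; remainder; combine; toℕ)
  import Data.Fin.Properties as Fin
  open import Data.List.Base using (List; []; _∷_; _++_; map; tabulate; allFin)
  open import Data.List.Membership.Propositional using (_∈_)
  open import Data.List.Relation.Unary.All as All using (All; []; _∷_)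
  import Data.List.Relation.Unary.All.Properties as All
  open import Data.List.Relation.Unary.Any using (here; there)
  open import Data.Integer.Base using (+_)
  open import Data.Nat.Base as ℕ using (ℕ; zero; suc; z≤n; s≤s)
  import Data.Nat.Properties as ℕ
  import Data.Nat.Tactic.RingSolver as ℕ
  open import Data.Product.Base using (_×_; _,_; proj₂)
  import Data.Product.Base as Product
  open import Data.Rational.Base hiding (truncate)
  open import Data.Rational.Properties
  open import Data.Rational.Solver
  open +-*-Solver using (solve; _:*_; _:+_; _:=_)
  open import Data.Vec.Base as Vec using (Vec; []; _∷_; lookup)
  import Data.Vec.Properties as Vec
  open import Function.Base using (_∘_)
  open import Function.Bundles using (mk⇔)
  open import Relation.Binary.Construct.Closure.ReflexiveTransitive using (ε; _◅_; _◅◅_)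
  open import Relation.Binary.Construct.Closure.Symmetric using (fwd; bwd)
  open import Relation.Binary.PropositionalEquality
    using (_≡_; refl; sym; trans; cong; cong₂; subst; module ≡-Reasoning)
  open import Relation.Nullary using (¬_; does; yes; no)
  open import Relation.Nullary.Decidable using (does-⇔; dec-true; dec-false)
  open import Relation.Unary using (Decidable)

  -- Expectation

  private variable
    A B : Set

  -- Natural values let counting inequalities pass under the expectation through `ι`.
  E : Dist A → (A → ℕ) → ℚ
  E []            f = 0ℚ
  E ((a , p) ∷ d) f = p * ι (f a) + E d f

  E-++ : ∀ (d e : Dist A) f → E (d ++ e) f ≡ E d f + E e f
  E-++ []            e f = sym (+-identityˡ _)
  E-++ ((a , p) ∷ d) e f = trans (cong (λ x → p * ι (f a) + x) (E-++ d e f)) (sym (+-assoc (p * ι (f a)) (E d f) (E e f)))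

  E-scale : ∀ p (d : Dist A) f → E (map (λ (b , q) → b , p * q) d) f ≡ p * E d f
  E-scale p []            f = sym (*-zeroʳ p)
  E-scale p ((a , q) ∷ d) f = trans (cong₂ _+_ (*-assoc p q _) (E-scale p d f)) (sym (*-distribˡ-+ p _ _))

  E-cong : ∀ (d : Dist A) {f g} → (∀ a → f a ≡ g a) → E d f ≡ E d g
  E-cong []            f≡g = refl
  E-cong ((a , p) ∷ d) f≡g = cong₂ _+_ (cong (λ x → p * ι x) (f≡g a)) (E-cong d f≡g)

  E-+ : ∀ (d : Dist A) f g → E d (λ a → f a ℕ.+ g a) ≡ E d f + E d g
  E-+ []            f g = sym (+-identityˡ 0ℚ)
  E-+ ((a , p) ∷ d) f g = trans (cong₂ (λ x y → p * x + y) (ι-+ (f a) (g a)) (E-+ d f g))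
    (solve 5 (λ p x y u v → p :* (x :+ y) :+ (u :+ v) := (p :* x :+ u) :+ (p :* y :+ v)) refl
      p (ι (f a)) (ι (g a)) (E d f) (E d g))

  E-*ˡ : ∀ (d : Dist A) x f → E d (λ a → x ℕ.* f a) ≡ ι x * E d f
  E-*ˡ []            x f = sym (*-zeroʳ (ι x))
  E-*ˡ ((a , p) ∷ d) x f = trans (cong₂ (λ y z → p * y + z) (ι-* x (f a)) (E-*ˡ d x f))
    (solve 4 (λ p x y e → p :* (x :* y) :+ x :* e := x :* (p :* y :+ e)) refl p (ι x) (ι (f a)) (E d f))

  E-mono : ∀ {d : Dist A} {f g} → All (λ (_ , p) → 0ℚ ≤ p) d → (∀ a → f a ℕ.≤ g a) → E d f ≤ E d g
  E-mono []          f≤g = ≤-refl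
  E-mono {d = (_ , p) ∷ _} (0≤p ∷ pos) f≤g =
    +-mono-≤ (*-monoˡ-≤-nonNeg p {{nonNegative 0≤p}} (ι-mono-≤ (f≤g _))) (E-mono pos f≤g)

  -- The tower rule, with the conditional expectation g y / x written without division. It is asked
  -- on the support only, since the one-step formula below is about graphs that the process can
  -- produce.
  E-bind : ∀ (d : Dist A) {k : A → Dist B} {f g x y} →
    All (λ (a , _) → E (k a) f * x ≡ ι (g a) * y) d → E (d >>= k) f * x ≡ E d g * y
  E-bind []            {x = x} {y} [] = trans (*-zeroˡ x) (sym (*-zeroˡ y))
  E-bind ((a , p) ∷ d) {k} {f} {g} {x} {y} (eq ∷ eqs) = begin
    E (((a , p) ∷ d) >>= k) f * x
      ≡⟨ cong (_* x) (E-++ (map (λ (b , q) → b , p * q) (k a)) (d >>= k) f) ⟩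
    (E (map _ (k a)) f + E (d >>= k) f) * x ≡⟨ cong (λ z → (z + E (d >>= k) f) * x) (E-scale p (k a) f) ⟩
    (p * E (k a) f + E (d >>= k) f) * x
      ≡⟨ solve 4 (λ p e f x → (p :* e :+ f) :* x := p :* (e :* x) :+ f :* x) refl p (E (k a) f) (E (d >>= k) f) x ⟩
    p * (E (k a) f * x) + E (d >>= k) f * x ≡⟨ cong₂ (λ u v → p * u + v) eq (E-bind d eqs) ⟩
    p * (ι (g a) * y) + E d g * y
      ≡⟨ solve 4 (λ p e f y → p :* (e :* y) :+ f :* y := (p :* e :+ f) :* y) refl p (ι (g a)) (E d g) y ⟩
    (p * ι (g a) + E d g) * y               ∎
    where open ≡-Reasoning

  E-map : ∀ (h : A → B) d f → E (mapDist h d) f ≡ E d (f ∘ h)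
  E-map h []            f = refl
  E-map h ((a , p) ∷ d) f = cong (λ x → p * ι (f (h a)) + x) (E-map h d f)

  indicator : ∀ {P : A → Set} → Decidable P → A → ℕ
  indicator P? a = if does (P? a) then 1 else 0

  ℙ≡E : ∀ {P : A → Set} (d : Dist A) (P? : Decidable P) → ℙ d P? ≡ E d (indicator P?)
  ℙ≡E []            P? = refl
  ℙ≡E ((a , p) ∷ d) P? with does (P? a)
  ... | true  = cong₂ _+_ (sym (*-identityʳ p)) (ℙ≡E d P?)
  ... | false = trans (ℙ≡E d P?) (trans (sym (+-identityˡ _)) (cong (_+ E d (indicator P?)) (sym (*-zeroʳ p))))

  E-cutSum : ∀ (d : Dist A) {x} n {F : Vec Bool n → A → ℕ} {H : Vec Bool n → ℕ} →
    (∀ c → E d (F c) * x ≡ ι (H c)) → E d (λ a → cutSum n (λ c → F c a)) * x ≡ ι (cutSum n H)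
  E-cutSum d     zero    eq = eq []
  E-cutSum d {x} (suc n) {F} {H} eq = E-cutSum d n λ c → begin
    E d (λ a → F (true ∷ c) a ℕ.+ F (false ∷ c) a) * x ≡⟨ cong (_* x) (E-+ d (F (true ∷ c)) (F (false ∷ c))) ⟩
    (E d (F (true ∷ c)) + E d (F (false ∷ c))) * x
      ≡⟨ *-distribʳ-+ x (E d (F (true ∷ c))) (E d (F (false ∷ c))) ⟩
    E d (F (true ∷ c)) * x + E d (F (false ∷ c)) * x   ≡⟨ cong₂ _+_ (eq (true ∷ c)) (eq (false ∷ c)) ⟩
    ι (H (true ∷ c)) + ι (H (false ∷ c))               ≡⟨ sym (ι-+ (H (true ∷ c)) (H (false ∷ c))) ⟩
    ι (H (true ∷ c) ℕ.+ H (false ∷ c))                 ∎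
    where open ≡-Reasoning

  -- Sums over vertices and edges

  finSum : ∀ {t} → (Fin t → ℕ) → ℕ
  finSum {zero}  h = 0
  finSum {suc t} h = h zero ℕ.+ finSum (h ∘ suc)

  edgeSum : ∀ {t} → (Fin t × Fin t → ℕ) → Multigraph t → ℕ
  edgeSum h []      = 0
  edgeSum h (e ∷ g) = h e ℕ.+ edgeSum h g

  finSum-0 : ∀ {t} → finSum {t} (λ _ → 0) ≡ 0
  finSum-0 {zero}  = refl
  finSum-0 {suc t} = finSum-0 {t}

  finSum-cong : ∀ {t} {f g : Fin t → ℕ} → (∀ i → f i ≡ g i) → finSum f ≡ finSum g
  finSum-cong {zero}  f≡g = refl
  finSum-cong {suc t} f≡g = cong₂ ℕ._+_ (f≡g zero) (finSum-cong (f≡g ∘ suc))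

  finSum-+ : ∀ {t} (f g : Fin t → ℕ) → finSum (λ i → f i ℕ.+ g i) ≡ finSum f ℕ.+ finSum g
  finSum-+ {zero}  f g = refl
  finSum-+ {suc t} f g = trans (cong ((f zero ℕ.+ g zero) ℕ.+_) (finSum-+ (f ∘ suc) (g ∘ suc)))
    (shuffle (f zero) (g zero) (finSum (f ∘ suc)) (finSum (g ∘ suc)))
    where
    shuffle : ∀ a b c d → a ℕ.+ b ℕ.+ (c ℕ.+ d) ≡ a ℕ.+ c ℕ.+ (b ℕ.+ d)
    shuffle = ℕ.solve-∀

  δ-suc : ∀ {t} (u s : Fin t) → δ (suc u) (suc s) ≡ δ u s
  δ-suc u s with u Fin.≟ s
  ... | yes _ = refl
  ... | no  _ = refl

  finSum-δ : ∀ {t} u (h : Fin t → ℕ) → finSum (λ s → δ u s ℕ.* h s) ≡ h u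
  finSum-δ {suc t} zero    h = trans (cong ((h zero ℕ.+ 0) ℕ.+_) (finSum-0 {t}))
    (trans (ℕ.+-identityʳ _) (ℕ.+-identityʳ _))
  finSum-δ {suc t} (suc u) h = trans (finSum-cong (λ s → cong (ℕ._* h (suc s)) (δ-suc u s))) (finSum-δ u (h ∘ suc))

  -- Double counting of edge ends; a loop contributes its vertex twice on both sides.
  handshake : ∀ {t} (h : Fin t → ℕ) g → finSum (λ s → deg g s ℕ.* h s) ≡ edgeSum (λ (u , w) → h u ℕ.+ h w) g
  handshake {t} h []            = finSum-0 {t}
  handshake h ((u , w) ∷ g) = begin
    finSum (λ s → (δ u s ℕ.+ δ w s ℕ.+ deg g s) ℕ.* h s)
      ≡⟨ finSum-cong (λ s → distrib (δ u s) (δ w s) (deg g s) (h s)) ⟩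
    finSum (λ s → δ u s ℕ.* h s ℕ.+ δ w s ℕ.* h s ℕ.+ deg g s ℕ.* h s)
      ≡⟨ finSum-+ _ (λ s → deg g s ℕ.* h s) ⟩
    finSum (λ s → δ u s ℕ.* h s ℕ.+ δ w s ℕ.* h s) ℕ.+ finSum (λ s → deg g s ℕ.* h s)
      ≡⟨ cong₂ ℕ._+_ (trans (finSum-+ _ (λ s → δ w s ℕ.* h s)) (cong₂ ℕ._+_ (finSum-δ u h) (finSum-δ w h))) (handshake h g) ⟩
    h u ℕ.+ h w ℕ.+ edgeSum (λ (u , w) → h u ℕ.+ h w) g ∎
    where
    open ≡-Reasoning
    distrib : ∀ a b c x → (a ℕ.+ b ℕ.+ c) ℕ.* x ≡ a ℕ.* x ℕ.+ b ℕ.* x ℕ.+ c ℕ.* x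
    distrib = ℕ.solve-∀

  -- Cuts of graphs

  -- Cuts list the newest vertex first.
  side : ∀ {t} → Vec Bool t → Fin t → Bool
  side c i = lookup c (opposite i)

  side-fromℕ : ∀ {t} b (c : Vec Bool t) → side (b ∷ c) (fromℕ t) ≡ b
  side-fromℕ {t} b c = cong (lookup (b ∷ c)) (Fin.toℕ-injective
    (trans (Fin.opposite-prop (fromℕ t)) (trans (cong (t ℕ.∸_) (Fin.toℕ-fromℕ t)) (ℕ.n∸n≡0 t))))

  opposite-inject₁ : ∀ {t} (i : Fin t) → opposite (inject₁ i) ≡ suc (opposite i)
  opposite-inject₁ zero    = refl
  opposite-inject₁ (suc i) = cong inject₁ (opposite-inject₁ i)

  side-inject₁ : ∀ {t} b (c : Vec Bool t) i → side (b ∷ c) (inject₁ i) ≡ side c i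
  side-inject₁ b c i = cong (lookup (b ∷ c)) (opposite-inject₁ i)

  -- A 0/1 indicator written as a product over the edges: multiplying an identity by it restricts
  -- the identity to closed cuts.
  closed : ∀ {t} → Vec Bool t → Multigraph t → ℕ
  closed c []            = 1
  closed c ((u , w) ∷ g) = agree (side c w) (side c u) ℕ.* closed c g

  closed-inject₁ : ∀ {t} b (c : Vec Bool t) g → closed (b ∷ c) (map (Product.map inject₁ inject₁) g) ≡ closed c g
  closed-inject₁ b c []            = refl
  closed-inject₁ b c ((u , w) ∷ g) =
    cong₂ ℕ._*_ (cong₂ agree (side-inject₁ b c w) (side-inject₁ b c u)) (closed-inject₁ b c g)

  closed-addVertex : ∀ {t} b (c : Vec Bool t) g s →
    closed (b ∷ c) (addVertex g s) ≡ agree (side (b ∷ c) s) b ℕ.* closed c g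
  closed-addVertex b c g s = cong₂ ℕ._*_ (cong (agree (side (b ∷ c) s)) (side-fromℕ b c)) (closed-inject₁ b c g)

  -- Ensures that every vertex is the first component of exactly one edge, which ties degrees to
  -- class sizes.
  data Grown : ∀ {t} → Multigraph t → Set where
    empty : Grown {0} []
    grow  : ∀ {t} {g : Multigraph t} → Grown g → ∀ s → Grown (addVertex g s)

  tails : ∀ {t} → Bool → Vec Bool t → Multigraph t → ℕ
  tails b c = edgeSum (λ (u , _) → agree (side c u) b)

  tails-inject₁ : ∀ {t} b x (c : Vec Bool t) g → tails b (x ∷ c) (map (Product.map inject₁ inject₁) g) ≡ tails b c g
  tails-inject₁ b x c []            = refl
  tails-inject₁ b x c ((u , _) ∷ g) = cong₂ ℕ._+_ (cong (λ y → agree y b) (side-inject₁ x c u)) (tails-inject₁ b x c g)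

  tails≡count : ∀ {t} b (c : Vec Bool t) {g} → Grown g → tails b c g ≡ count b c
  tails≡count b []      empty              = refl
  tails≡count b (x ∷ c) (grow {g = g} G s) =
    cong₂ ℕ._+_ (cong (λ y → agree y b) (side-fromℕ x c)) (trans (tails-inject₁ b x c g) (tails≡count b c G))

  agree-both : ∀ x y b → agree x y ℕ.* (agree y b ℕ.+ agree x b) ≡ agree x y ℕ.* (2 ℕ.* agree y b)
  agree-both true  true  true  = refl
  agree-both true  true  false = refl
  agree-both true  false _     = refl
  agree-both false true  _     = refl
  agree-both false false true  = refl
  agree-both false false false = refl

  -- In a closed cut both ends of an edge have the colour of its tail, so a class has twice as many
  -- edge ends as tails. The factor `closed c g` stands for the assumption that the cut is closed.
  closed-volume : ∀ {t} b (c : Vec Bool t) g →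
    closed c g ℕ.* edgeSum (λ (u , w) → agree (side c u) b ℕ.+ agree (side c w) b) g ≡
    closed c g ℕ.* (2 ℕ.* tails b c g)
  closed-volume b c []            = refl
  closed-volume b c ((u , w) ∷ g) = begin
    a ℕ.* C ℕ.* (x ℕ.+ y ℕ.+ S)             ≡⟨ split a C (x ℕ.+ y) S ⟩
    C ℕ.* (a ℕ.* (x ℕ.+ y)) ℕ.+ a ℕ.* (C ℕ.* S)
      ≡⟨ cong₂ (λ p q → C ℕ.* p ℕ.+ a ℕ.* q) (agree-both (side c w) (side c u) b) (closed-volume b c g) ⟩
    C ℕ.* (a ℕ.* (2 ℕ.* x)) ℕ.+ a ℕ.* (C ℕ.* (2 ℕ.* T)) ≡⟨ unsplit a C x T ⟩
    a ℕ.* C ℕ.* (2 ℕ.* (x ℕ.+ T))           ∎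
    where
    open ≡-Reasoning
    a = agree (side c w) (side c u)
    x = agree (side c u) b
    y = agree (side c w) b
    C = closed c g
    S = edgeSum (λ (u , w) → agree (side c u) b ℕ.+ agree (side c w) b) g
    T = tails b c g
    split : ∀ a C p S → a ℕ.* C ℕ.* (p ℕ.+ S) ≡ C ℕ.* (a ℕ.* p) ℕ.+ a ℕ.* (C ℕ.* S)
    split = ℕ.solve-∀
    unsplit : ∀ a C x T → C ℕ.* (a ℕ.* (2 ℕ.* x)) ℕ.+ a ℕ.* (C ℕ.* (2 ℕ.* T)) ≡ a ℕ.* C ℕ.* (2 ℕ.* (x ℕ.+ T))
    unsplit = ℕ.solve-∀

  -- One step of the process

  -- The enumeration `r` is arbitrary because the induction passes from `r` to `r ∘ suc`.
  E-choose : ∀ {t t′} d (r : Fin t′ → Fin t) (a : Fin t → A) (w : Fin t → ℕ) f →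
    E (map (λ s → a s , + w s / suc d) (tabulate r)) f ≡ inv d * ι (finSum (λ i → w (r i) ℕ.* f (a (r i))))
  E-choose {t′ = zero}   d r a w f = sym (*-zeroʳ (inv d))
  E-choose {t′ = suc t′} d r a w f = begin
    + w s / suc d * ι (f (a s)) + E (map _ (tabulate (r ∘ suc))) f
      ≡⟨ cong₂ (λ x y → x * ι (f (a s)) + y) (/≡ι*inv (w s) d) (E-choose d (r ∘ suc) a w f) ⟩
    ι (w s) * inv d * ι (f (a s)) + inv d * ι rest
      ≡⟨ solve 4 (λ w i f r → w :* i :* f :+ i :* r := i :* (w :* f :+ r)) refl (ι (w s)) (inv d) (ι (f (a s))) (ι rest) ⟩
    inv d * (ι (w s) * ι (f (a s)) + ι rest)
      ≡⟨ cong (λ x → inv d * (x + ι rest)) (sym (ι-* (w s) (f (a s)))) ⟩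
    inv d * (ι (w s ℕ.* f (a s)) + ι rest)
      ≡⟨ cong (inv d *_) (sym (ι-+ (w s ℕ.* f (a s)) rest)) ⟩
    inv d * ι (w s ℕ.* f (a s) ℕ.+ rest) ∎
    where
    open ≡-Reasoning
    s = r zero
    rest = finSum (λ i → w (r (suc i)) ℕ.* f (a (r (suc i))))

  -- Of the 2t+1 units of attachment weight, the class of colour `b` holds twice its size
  -- (`oldSum`), and the loop, which never crosses a cut, adds 1 (`loop`).
  E-attach-closed : ∀ {t} b (c : Vec Bool t) {g} → Grown g →
    E (attach g) (closed (b ∷ c)) * ι (suc (2 ℕ.* t)) ≡ ι (closed c g) * ι (suc (2 ℕ.* count b c))
  E-attach-closed {t} b c {g} G = begin
    E (attach g) f * ι (suc d)
      ≡⟨ cong (_* ι (suc d)) (trans (E-++ (map _ (allFin t)) _ f)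
           (cong (_+ (inv d * ι (f (addVertex g (fromℕ t))) + 0ℚ))
             (E-choose d (λ s → s) (λ s → addVertex g (inject₁ s)) (deg g) f))) ⟩
    (inv d * ι (finSum old) + (inv d * ι (f (addVertex g (fromℕ t))) + 0ℚ)) * ι (suc d)
      ≡⟨ cong (λ x → (inv d * ι (finSum old) + x) * ι (suc d)) (+-identityʳ _) ⟩
    (inv d * ι (finSum old) + inv d * ι (f (addVertex g (fromℕ t)))) * ι (suc d)
      ≡⟨ solve 4 (λ i x y n → (i :* x :+ i :* y) :* n := (i :* n) :* (x :+ y)) refl (inv d) (ι (finSum old)) _ (ι (suc d)) ⟩
    inv d * ι (suc d) * (ι (finSum old) + ι (f (addVertex g (fromℕ t))))
      ≡⟨ trans (cong (_* (ι (finSum old) + ι (f (addVertex g (fromℕ t))))) (inv*ι d))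
           (*-identityˡ (ι (finSum old) + ι (f (addVertex g (fromℕ t))))) ⟩
    ι (finSum old) + ι (f (addVertex g (fromℕ t)))
      ≡⟨ sym (ι-+ (finSum old) _) ⟩
    ι (finSum old ℕ.+ f (addVertex g (fromℕ t)))
      ≡⟨ cong ι (cong₂ ℕ._+_ oldSum loop) ⟩
    ι (closed c g ℕ.* (2 ℕ.* count b c) ℕ.+ closed c g)
      ≡⟨ cong ι (trans (ℕ.+-comm _ (closed c g)) (sym (ℕ.*-suc (closed c g) _))) ⟩
    ι (closed c g ℕ.* suc (2 ℕ.* count b c))
      ≡⟨ ι-* (closed c g) _ ⟩
    ι (closed c g) * ι (suc (2 ℕ.* count b c)) ∎
    where
    open ≡-Reasoning
    d = 2 ℕ.* t
    f = closed (b ∷ c)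
    old : Fin t → ℕ
    old s = deg g s ℕ.* f (addVertex g (inject₁ s))
    h : Fin t → ℕ
    h s = agree (side c s) b
    loop : f (addVertex g (fromℕ t)) ≡ closed c g
    loop = trans (closed-addVertex b c g (fromℕ t))
      (trans (cong (λ x → agree x b ℕ.* closed c g) (side-fromℕ b c))
        (trans (cong (ℕ._* closed c g) (agree-refl b)) (ℕ.*-identityˡ _)))
    finSum-*ˡ : ∀ {t} x (h : Fin t → ℕ) → finSum (λ i → x ℕ.* h i) ≡ x ℕ.* finSum h
    finSum-*ˡ {zero}  x h = sym (ℕ.*-zeroʳ x)
    finSum-*ˡ {suc t} x h = trans (cong ((x ℕ.* h zero) ℕ.+_) (finSum-*ˡ x (h ∘ suc))) (sym (ℕ.*-distribˡ-+ x (h zero) _))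
    move : ∀ p q r → p ℕ.* (q ℕ.* r) ≡ r ℕ.* (p ℕ.* q)
    move = ℕ.solve-∀
    oldSum : finSum old ≡ closed c g ℕ.* (2 ℕ.* count b c)
    oldSum = begin
      finSum old
        ≡⟨ finSum-cong (λ s → trans
             (cong (deg g s ℕ.*_) (trans (closed-addVertex b c g (inject₁ s))
               (cong (λ x → agree x b ℕ.* closed c g) (side-inject₁ b c s))))
             (move (deg g s) (h s) (closed c g))) ⟩
      finSum (λ s → closed c g ℕ.* (deg g s ℕ.* h s))
        ≡⟨ finSum-*ˡ (closed c g) (λ s → deg g s ℕ.* h s) ⟩
      closed c g ℕ.* finSum (λ s → deg g s ℕ.* h s)
        ≡⟨ cong (closed c g ℕ.*_) (handshake h g) ⟩
      closed c g ℕ.* edgeSum (λ (u , w) → h u ℕ.+ h w) g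
        ≡⟨ closed-volume b c g ⟩
      closed c g ℕ.* (2 ℕ.* tails b c g)
        ≡⟨ cong (λ x → closed c g ℕ.* (2 ℕ.* x)) (tails≡count b c G) ⟩
      closed c g ℕ.* (2 ℕ.* count b c) ∎

  -- The exact probability that a cut is closed

  Supported : ∀ {t} → Multigraph t × ℚ → Set
  Supported (g , p) = Grown g × 0ℚ ≤ p

  0≤/ : ∀ a d → 0ℚ ≤ + a / suc d
  0≤/ a d = nonNegative⁻¹ _ {{normalize-nonNeg a (suc d)}}

  0≤* : ∀ {p q} → 0ℚ ≤ p → 0ℚ ≤ q → 0ℚ ≤ p * q
  0≤* {p} {q} 0≤p 0≤q = nonNegative⁻¹ (p * q) {{nonNeg*nonNeg⇒nonNeg p {{nonNegative 0≤p}} q {{nonNegative 0≤q}}}}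

  attach-supported : ∀ {t} {g : Multigraph t} → Grown g → All Supported (attach g)
  attach-supported {t} {g} G = All.++⁺
    (All.map⁺ (All.universal (λ s → grow G (inject₁ s) , 0≤/ (deg g s) (2 ℕ.* t)) (allFin t)))
    ((grow G (fromℕ t) , 0≤/ 1 (2 ℕ.* t)) ∷ [])

  bind-supported : ∀ {t} (d : Dist (Multigraph t)) → All Supported d → All Supported (d >>= attach)
  bind-supported []            []                = []
  bind-supported ((g , p) ∷ d) ((G , 0≤p) ∷ sup) = All.++⁺
    (All.map⁺ (All.map (λ (G′ , 0≤q) → G′ , 0≤* 0≤p 0≤q) (attach-supported G)))
    (bind-supported d sup)

  G₁-supported : ∀ N → All Supported (G₁ N)
  G₁-supported zero    = (empty , 0≤ι 1) ∷ []
  G₁-supported (suc t) = bind-supported (G₁ t) (G₁-supported t)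

  -- The one-step probabilities depend on `c` alone, so they multiply: numerators to `closedWeight`,
  -- denominators to `oddProduct`.
  E-closed : ∀ N (c : Vec Bool N) → E (G₁ N) (closed c) * ι (oddProduct N) ≡ ι (closedWeight c)
  E-closed zero    []      = refl
  E-closed (suc t) (b ∷ c) = begin
    E (G₁ t >>= attach) (closed (b ∷ c)) * ι (suc (2 ℕ.* t) ℕ.* oddProduct t)
      ≡⟨ cong (E (G₁ t >>= attach) (closed (b ∷ c)) *_) (ι-* (suc (2 ℕ.* t)) (oddProduct t)) ⟩
    E (G₁ t >>= attach) (closed (b ∷ c)) * (ι (suc (2 ℕ.* t)) * ι (oddProduct t))
      ≡⟨ sym (*-assoc (E (G₁ t >>= attach) (closed (b ∷ c))) _ _) ⟩
    E (G₁ t >>= attach) (closed (b ∷ c)) * ι (suc (2 ℕ.* t)) * ι (oddProduct t)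
      ≡⟨ cong (_* ι (oddProduct t)) (E-bind (G₁ t) (All.map (λ (G , _) → E-attach-closed b c G) (G₁-supported t))) ⟩
    E (G₁ t) (closed c) * ι (suc (2 ℕ.* count b c)) * ι (oddProduct t)
      ≡⟨ solve 3 (λ x y z → x :* y :* z := y :* (x :* z)) refl (E (G₁ t) (closed c)) _ _ ⟩
    ι (suc (2 ℕ.* count b c)) * (E (G₁ t) (closed c) * ι (oddProduct t))
      ≡⟨ cong (ι (suc (2 ℕ.* count b c)) *_) (E-closed t c) ⟩
    ι (suc (2 ℕ.* count b c)) * ι (closedWeight c)
      ≡⟨ sym (ι-* (suc (2 ℕ.* count b c)) (closedWeight c)) ⟩
    ι (closedWeight (b ∷ c)) ∎
    where open ≡-Reasoning

  closed-all : ∀ {t} (c : Vec Bool t) g → (∀ {u w} → (u , w) ∈ g → side c u ≡ side c w) → closed c g ≡ 1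
  closed-all c []            same = refl
  closed-all c ((u , w) ∷ g) same = cong₂ ℕ._*_
    (trans (cong (agree (side c w)) (same (here refl))) (agree-refl (side c w)))
    (closed-all c g (same ∘ there))

  -- The constant cut is always closed, so E-closed also gives the total mass.
  E-1 : ∀ N → E (G₁ N) (λ _ → 1) ≡ 1ℚ
  E-1 N = ≤-antisym
    (*-cancelʳ-≤-pos (ι D) {{positive 0<D}} (≤-reflexive eq))
    (*-cancelʳ-≤-pos (ι D) {{positive 0<D}} (≤-reflexive (sym eq)))
    where
    open ≡-Reasoning
    D = oddProduct N
    0<D = 0<ι D {{oddProduct≢0 N}}
    const : Vec Bool N
    const = Vec.replicate N true
    weight : ∀ N → closedWeight (Vec.replicate N true) ≡ oddProduct N
    weight zero    = refl
    weight (suc t) = cong₂ ℕ._*_ (cong (λ x → suc (2 ℕ.* x)) (trans (count-replicate t true true) (ℕ.*-identityʳ t))) (weight t)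
    eq : E (G₁ N) (λ _ → 1) * ι D ≡ 1ℚ * ι D
    eq = begin
      E (G₁ N) (λ _ → 1) * ι D
        ≡⟨ cong (_* ι D) (E-cong (G₁ N) (λ g → sym (closed-all const g (λ {u} {w} _ →
             trans (Vec.lookup-replicate (opposite u) true) (sym (Vec.lookup-replicate (opposite w) true)))))) ⟩
      E (G₁ N) (closed const) * ι D   ≡⟨ E-closed N const ⟩
      ι (closedWeight const)          ≡⟨ cong ι (weight N) ⟩
      ι D                             ≡⟨ sym (*-identityˡ (ι D)) ⟩
      1ℚ * ι D                        ∎

  -- Merging blocks of vertices

  -- Reversing the vertex order sends blocks to blocks. This reconciles cuts, read from the newest
  -- vertex, with `quotient`, which numbers blocks from the oldest.
  opposite-combine : ∀ {n m} (i : Fin n) (j : Fin m) → opposite (combine i j) ≡ combine (opposite i) (opposite j)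
  opposite-combine {n} {m} i j = Fin.toℕ-injective (begin
    toℕ (opposite (combine i j))            ≡⟨ Fin.opposite-prop (combine i j) ⟩
    n ℕ.* m ℕ.∸ suc (toℕ (combine i j))     ≡⟨ cong (λ x → n ℕ.* m ℕ.∸ suc x) (Fin.toℕ-combine i j) ⟩
    n ℕ.* m ℕ.∸ suc (m ℕ.* toℕ i ℕ.+ toℕ j) ≡⟨ arithmetic (toℕ i) (toℕ j) (Fin.toℕ<n i) (Fin.toℕ<n j) ⟩
    m ℕ.* (n ℕ.∸ suc (toℕ i)) ℕ.+ (m ℕ.∸ suc (toℕ j))
      ≡⟨ sym (cong₂ (λ x y → m ℕ.* x ℕ.+ y) (Fin.opposite-prop i) (Fin.opposite-prop j)) ⟩
    m ℕ.* toℕ (opposite i) ℕ.+ toℕ (opposite j) ≡⟨ sym (Fin.toℕ-combine (opposite i) (opposite j)) ⟩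
    toℕ (combine (opposite i) (opposite j)) ∎)
    where
    open ≡-Reasoning
    arithmetic : ∀ {n m} a b → a ℕ.< n → b ℕ.< m →
      n ℕ.* m ℕ.∸ suc (m ℕ.* a ℕ.+ b) ≡ m ℕ.* (n ℕ.∸ suc a) ℕ.+ (m ℕ.∸ suc b)
    arithmetic a b a<n b<m with p , refl ← ℕ.m≤n⇒∃[o]m+o≡n a<n | q , refl ← ℕ.m≤n⇒∃[o]m+o≡n b<m = begin
      (suc a ℕ.+ p) ℕ.* (suc b ℕ.+ q) ℕ.∸ suc ((suc b ℕ.+ q) ℕ.* a ℕ.+ b)
        ≡⟨ cong (ℕ._∸ suc ((suc b ℕ.+ q) ℕ.* a ℕ.+ b)) (identity a b p q) ⟩
      (suc ((suc b ℕ.+ q) ℕ.* a ℕ.+ b) ℕ.+ ((suc b ℕ.+ q) ℕ.* p ℕ.+ q)) ℕ.∸ suc ((suc b ℕ.+ q) ℕ.* a ℕ.+ b)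
        ≡⟨ ℕ.m+n∸m≡n (suc ((suc b ℕ.+ q) ℕ.* a ℕ.+ b)) _ ⟩
      (suc b ℕ.+ q) ℕ.* p ℕ.+ q
        ≡⟨ sym (cong₂ (λ x y → (suc b ℕ.+ q) ℕ.* x ℕ.+ y) (ℕ.m+n∸m≡n (suc a) p) (ℕ.m+n∸m≡n (suc b) q)) ⟩
      (suc b ℕ.+ q) ℕ.* (suc a ℕ.+ p ℕ.∸ suc a) ℕ.+ (suc b ℕ.+ q ℕ.∸ suc b) ∎
      where
      identity : ∀ a b p q → (suc a ℕ.+ p) ℕ.* (suc b ℕ.+ q) ≡
        suc ((suc b ℕ.+ q) ℕ.* a ℕ.+ b) ℕ.+ ((suc b ℕ.+ q) ℕ.* p ℕ.+ q)
      identity = ℕ.solve-∀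

  side-refine : ∀ {n} m (c : Vec Bool n) i → side (refine m c) i ≡ side c (quotient m i)
  side-refine {n} m c i = begin
    lookup (refine m c) (opposite i)
      ≡⟨ cong (λ x → lookup (refine m c) (opposite x)) (sym (Fin.combine-remQuot {n} m i)) ⟩
    lookup (refine m c) (opposite (combine q r))
      ≡⟨ cong (lookup (refine m c)) (opposite-combine q r) ⟩
    lookup (refine m c) (combine (opposite q) (opposite r))
      ≡⟨ Vec.lookup-concat (Vec.map (Vec.replicate m) c) (opposite q) (opposite r) ⟩
    lookup (lookup (Vec.map (Vec.replicate m) c) (opposite q)) (opposite r)
      ≡⟨ cong (λ x → lookup x (opposite r)) (Vec.lookup-map (opposite q) (Vec.replicate m) c) ⟩
    lookup (Vec.replicate m (side c q)) (opposite r)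
      ≡⟨ Vec.lookup-replicate (opposite r) (side c q) ⟩
    side c q ∎
    where
    open ≡-Reasoning
    q = quotient {n} m i
    r = remainder {n} m i

  -- Merging keeps the edges, and `refine` gives each vertex the colour of its block; `E-closed`
  -- thus applies to the merged graph.
  closed-merge : ∀ {n} m (c : Vec Bool n) g → closed c (merge m n g) ≡ closed (refine m c) g
  closed-merge m c []            = refl
  closed-merge m c ((u , w) ∷ g) = cong₂ ℕ._*_
    (sym (cong₂ agree (side-refine m c w) (side-refine m c u))) (closed-merge m c g)

  -- Proper closed cuts and connectedness

  closedCuts : ∀ {n} → Multigraph n → ℕ
  closedCuts {n} g = cutSum n (λ c → isProper c ℕ.* closed c g)

  E-closedCuts : ∀ m n → E (G m n) closedCuts * ι (oddProduct (n ℕ.* m)) ≡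
    ι (cutSum n (λ c → isProper c ℕ.* closedWeight (refine m c)))
  E-closedCuts m n = E-cutSum (G m n) n λ c → begin
    E (G m n) (λ g → isProper c ℕ.* closed c g) * ι D
      ≡⟨ cong (_* ι D) (E-*ˡ (G m n) (isProper c) (closed c)) ⟩
    ι (isProper c) * E (G m n) (closed c) * ι D              ≡⟨ *-assoc (ι (isProper c)) _ (ι D) ⟩
    ι (isProper c) * (E (G m n) (closed c) * ι D)
      ≡⟨ cong (λ x → ι (isProper c) * (x * ι D)) (trans (E-map (merge m n) (G₁ (n ℕ.* m)) (closed c))
           (E-cong (G₁ (n ℕ.* m)) (closed-merge m c))) ⟩
    ι (isProper c) * (E (G₁ (n ℕ.* m)) (closed (refine m c)) * ι D)
      ≡⟨ cong (ι (isProper c) *_) (E-closed (n ℕ.* m) (refine m c)) ⟩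
    ι (isProper c) * ι (closedWeight (refine m c))           ≡⟨ sym (ι-* (isProper c) _) ⟩
    ι (isProper c ℕ.* closedWeight (refine m c))             ∎
    where
    open ≡-Reasoning
    D = oddProduct (n ℕ.* m)

  lookup⇒count : ∀ {n b} (c : Vec Bool n) i → lookup c i ≡ b → 1 ℕ.≤ count b c
  lookup⇒count (b ∷ c) zero    refl rewrite agree-refl b = s≤s z≤n
  lookup⇒count {b = b} (x ∷ c) (suc i) eq = ℕ.≤-trans (lookup⇒count c i eq) (ℕ.m≤n+m _ (agree x b))

  proper≡1 : ∀ {k l} → 1 ℕ.≤ k → 1 ℕ.≤ l → proper k l ≡ 1
  proper≡1 (s≤s _) (s≤s _) = refl

  -- The component of a vertex `u` that does not reach some `w` is one side of the cut: no edge
  -- leaves it, and `w` lies outside.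
  disconnected⇒closedCut : ∀ {n} (g : Multigraph n) → ¬ Connected g → 1 ℕ.≤ closedCuts g
  disconnected⇒closedCut {n} g ¬conn
    with u , ¬u ← Fin.¬∀⟶∃¬ n _ (λ u → Fin.all? (reachable? g u)) ¬conn
    with w , ¬uw ← Fin.¬∀⟶∃¬ n _ (reachable? g u) ¬u = begin
      1                          ≡⟨ sym (cong₂ ℕ._*_ isProper≡1 (closed-all c g same)) ⟩
      isProper c ℕ.* closed c g  ≤⟨ term≤cutSum n (λ c → isProper c ℕ.* closed c g) c ⟩
      closedCuts g               ∎
      where
      open ℕ.≤-Reasoning
      c : Vec Bool n
      c = Vec.tabulate (λ i → does (reachable? g u (opposite i)))
      side-c : ∀ i → side c i ≡ does (reachable? g u i)
      side-c i = trans (Vec.lookup∘tabulate _ (opposite i)) (cong (λ x → does (reachable? g u x)) (Fin.opposite-involutive i))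
      same : ∀ {a b} → (a , b) ∈ g → side c a ≡ side c b
      same {a} {b} e = trans (side-c a) (trans
        (does-⇔ (mk⇔ (λ p → p ◅◅ (fwd e ◅ ε)) (λ p → p ◅◅ (bwd e ◅ ε))) (reachable? g u a) (reachable? g u b))
        (sym (side-c b)))
      isProper≡1 : isProper c ≡ 1
      isProper≡1 = proper≡1
        (lookup⇒count c (opposite u) (trans (side-c u) (dec-true (reachable? g u u) ε)))
        (lookup⇒count c (opposite w) (trans (side-c w) (dec-false (reachable? g u w) ¬uw)))

  1≤indicator+ : ∀ {P : A → Set} (P? : Decidable P) a {k} → (¬ P a → 1 ℕ.≤ k) → 1 ℕ.≤ indicator P? a ℕ.+ k
  1≤indicator+ P? a ¬Pa⇒1≤k with P? a
  ... | yes _   = s≤s z≤n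
  ... | no  ¬Pa = ¬Pa⇒1≤k ¬Pa

  indicator≤1 : ∀ {P : A → Set} (P? : Decidable P) a → indicator P? a ℕ.≤ 1
  indicator≤1 P? a with does (P? a)
  ... | true  = s≤s z≤n
  ... | false = z≤n

  -- The first-moment method: at every graph, the indicator of connectedness plus the number of
  -- proper closed cuts is at least 1. With total mass 1, expectations give `1-X≤Z`.
  disconnected≤ : ∀ m {n₀ n} → 8 ℕ.≤ n₀ → n₀ ℕ.≤ n →
    ∣ 1ℚ - ℙ (G (2 ℕ.+ m) n) connected? ∣ * ι n ≤ ι (properConstant n₀)
  disconnected≤ m {n₀} {n} 8≤n₀ n₀≤n = *-cancelʳ-≤-pos (ι D) {{positive 0<D}} (begin
    ∣ 1ℚ - X ∣ * ι n * ι D     ≡⟨ cong (λ x → x * ι n * ι D) (0≤p⇒∣p∣≡p 0≤1-X) ⟩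
    (1ℚ - X) * ι n * ι D
      ≤⟨ *-monoʳ-≤-nonNeg (ι D) {{nonNegative (0≤ι D)}} (*-monoʳ-≤-nonNeg (ι n) {{nonNegative (0≤ι n)}} 1-X≤Z) ⟩
    Z * ι n * ι D              ≡⟨ solve 3 (λ x y z → x :* y :* z := y :* (x :* z)) refl Z (ι n) (ι D) ⟩
    ι n * (Z * ι D)            ≡⟨ cong (ι n *_) (E-closedCuts M n) ⟩
    ι n * ι S                  ≡⟨ sym (ι-* n S) ⟩
    ι (n ℕ.* S)                ≤⟨ ι-mono-≤ (closedSum≤ m 8≤n₀ n₀≤n) ⟩
    ι (properConstant n₀ ℕ.* D) ≡⟨ ι-* (properConstant n₀) D ⟩
    ι (properConstant n₀) * ι D ∎)
    where
    open ≤-Reasoning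
    M = 2 ℕ.+ m
    D = oddProduct (n ℕ.* M)
    S = cutSum n (λ c → isProper c ℕ.* closedWeight (refine M c))
    0<D = 0<ι D {{oddProduct≢0 (n ℕ.* M)}}
    X = ℙ (G M n) connected?
    Z = E (G M n) closedCuts
    weights≥0 : All (λ (_ , p) → 0ℚ ≤ p) (G M n)
    weights≥0 = All.map⁺ (All.map proj₂ (G₁-supported (n ℕ.* M)))
    mass : E (G M n) (λ _ → 1) ≡ 1ℚ
    mass = trans (E-map (merge M n) (G₁ (n ℕ.* M)) (λ _ → 1)) (E-1 (n ℕ.* M))
    X≡ : X ≡ E (G M n) (indicator connected?)
    X≡ = ℙ≡E (G M n) connected?
    X≤1 : X ≤ 1ℚ
    X≤1 = begin
      X                               ≡⟨ X≡ ⟩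
      E (G M n) (indicator connected?) ≤⟨ E-mono weights≥0 (indicator≤1 connected?) ⟩
      E (G M n) (λ _ → 1)              ≡⟨ mass ⟩
      1ℚ                               ∎
    1≤X+Z : 1ℚ ≤ X + Z
    1≤X+Z = begin
      1ℚ                                   ≡⟨ sym mass ⟩
      E (G M n) (λ _ → 1)
        ≤⟨ E-mono weights≥0 (λ g → 1≤indicator+ connected? g (disconnected⇒closedCut g)) ⟩
      E (G M n) (λ g → indicator connected? g ℕ.+ closedCuts g)
        ≡⟨ E-+ (G M n) (indicator connected?) closedCuts ⟩
      E (G M n) (indicator connected?) + Z ≡⟨ cong (_+ Z) (sym X≡) ⟩
      X + Z                                ∎
    0≤1-X : 0ℚ ≤ 1ℚ - X
    0≤1-X = subst (_≤ 1ℚ - X) (+-inverseʳ X) (+-monoˡ-≤ (- X) X≤1)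
    1-X≤Z : 1ℚ - X ≤ Z
    1-X≤Z = begin
      1ℚ - X       ≤⟨ +-monoˡ-≤ (- X) 1≤X+Z ⟩
      X + Z - X    ≡⟨ cong (_- X) (+-comm X Z) ⟩
      Z + X - X    ≡⟨ +-assoc Z X (- X) ⟩
      Z + (X - X)  ≡⟨ cong (λ x → Z + x) (+-inverseʳ X) ⟩
      Z + 0ℚ       ≡⟨ +-identityʳ Z ⟩
      Z            ∎

-- Lower bounds for the right-hand side

module Analysis where

  open Embedding
  open import Algebra.Bundles using (CommutativeRing)
  open import Data.Integer.Base as ℤ using (+_)
  open import Data.Nat.Base as ℕ using (ℕ; zero; suc; z≤n; s≤s; _!)
  import Data.Nat.Properties as ℕ
  open import Data.Product.Base using (Σ; ∃; _×_; _,_; proj₁; proj₂)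
  open import Data.Rational.Base hiding (truncate)
  open import Data.Rational.Properties
  open import Data.Rational.Solver
  open import Algebra.Properties.CommutativeSemiring.Exp
    (CommutativeRing.commutativeSemiring +-*-commutativeRing) using (^-distrib-*)
  open +-*-Solver using (solve; _:*_; _:=_)
  open import Relation.Binary.PropositionalEquality
    using (_≡_; refl; sym; trans; cong; cong₂; subst; module ≡-Reasoning)
  open import Relation.Nullary using (¬_; yes; no)
  open import Relation.Nullary.Decidable using (toWitness)
  open ℝ⁺

  0<½ : 0ℚ < ½
  0<½ = toWitness {a? = 0ℚ <? ½} _

  half< : ∀ {p} → 0ℚ < p → ½ * p < p
  half< {p} 0<p = subst (½ * p <_) (*-identityˡ p)
    (*-monoˡ-<-pos p {{positive 0<p}} (toWitness {a? = ½ <? 1ℚ} _))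

  -- For r ≤ 1 every power r ^ k with k at least the numerators of the two
  -- exponents bracketing y lies below x ^ y.
  power-lower : ∀ y → ∃ λ k → ∀ x {r} → 0ℚ < r → r ≤ 1ℚ → x ∋ r →
    ∀ {t} → t < r ^ℚ suc k → (x ^ᵣ y) ∋ t
  power-lower y with open′ y (0∈ y) | bounded y
  ... | s₁ , 0<s₁ , ys₁ | s₂ , ¬ys₂ = k , λ x {r} 0<r r≤1 xr t<r^k →
      r ^ℚ suc k
      , (<⇒≤ (^-pos 0<r (suc k)) , s₁ , s₂ , 0<s₁ , ys₁ , ¬ys₂
        , (r , 0<r , xr , le 0<r r≤1 s₁ (ℕ.m≤n⇒m≤1+n (ℕ.m≤m+n _ _)))
        , (r , 0<r , xr , le 0<r r≤1 s₂ (ℕ.m≤n⇒m≤1+n (ℕ.m≤n+m _ ℤ.∣ ↥ s₁ ∣))))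
      , t<r^k
    where
    k = ℤ.∣ ↥ s₁ ∣ ℕ.+ ℤ.∣ ↥ s₂ ∣
    -- Powers of r ≤ 1 decrease in the exponent: the denominator is at least 1, the numerator at
    -- most `suc k`.
    le : ∀ {r} → 0ℚ < r → r ≤ 1ℚ → ∀ s → ℤ.∣ ↥ s ∣ ℕ.≤ suc k → (r ^ℚ suc k) ^ℚ ↧ₙ s ≤ r ^ℚ ℤ.∣ ↥ s ∣
    le {r} 0<r r≤1 s num≤k = ≤-trans
      (subst ((r ^ℚ suc k) ^ℚ ↧ₙ s ≤_) (*-identityʳ (r ^ℚ suc k))
        (^-antimonoʳ-≤ (^-pos 0<r (suc k)) (^-≤1 0<r r≤1 (suc k)) {1} {↧ₙ s} (s≤s z≤n)))
      (^-antimonoʳ-≤ 0<r r≤1 num≤k)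

  /ᵣ-lower : ∀ x y {r s t} → x ∋ r → ¬ (y ∋ s) → t * s ≡ r → ∀ {q} → q < t → (x /ᵣ y) ∋ q
  /ᵣ-lower x y {s = s} {t} xr ¬ys ts≡r q<t = t , (s , ¬ys , subst (x ∋_) (sym ts≡r) xr) , q<t

  *ᵣ-lower : ∀ x y {a b} → 0ℚ < a → 0ℚ < b → x ∋ a → y ∋ b → ∀ {q} → q < a * b → (x *ᵣ y) ∋ q
  *ᵣ-lower x y {a} {b} 0<a 0<b xa yb q<ab = a * b , (a , b , 0<a , 0<b , xa , yb , refl) , q<ab

  expTerm*! : ∀ q k → expTerm q k * ι (k !) ≡ q ^ℚ k
  expTerm*! q zero    = refl
  expTerm*! q (suc k) = begin
    expTerm q k * (q * inv k) * ι (suc k ℕ.* k !)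
      ≡⟨ cong (expTerm q k * (q * inv k) *_) (ι-* (suc k) (k !)) ⟩
    expTerm q k * (q * inv k) * (ι (suc k) * ι (k !))
      ≡⟨ solve 5 (λ e q i s f → e :* (q :* i) :* (s :* f) := (i :* s) :* (q :* (e :* f))) refl
           (expTerm q k) q (inv k) (ι (suc k)) (ι (k !)) ⟩
    inv k * ι (suc k) * (q * (expTerm q k * ι (k !)))
      ≡⟨ cong₂ (λ x y → x * (q * y)) (inv*ι k) (expTerm*! q k) ⟩
    1ℚ * (q * q ^ℚ k)                                      ≡⟨ *-identityˡ _ ⟩
    q ^ℚ suc k                                             ∎
    where open ≡-Reasoning

  expTerm≤expSum : ∀ q → 0ℚ < q → ∀ k → expTerm q k ≤ expSum q k
  expTerm≤expSum q 0<q zero    = ≤-refl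
  expTerm≤expSum q 0<q (suc k) = subst (_≤ expSum q (suc k)) (+-identityˡ _)
    (+-monoˡ-≤ (expTerm q (suc k)) (≤-trans (<⇒≤ (expTerm-pos q 0<q k)) (expTerm≤expSum q 0<q k)))

  module _ (n : ℕ) (3≤n : 3 ℕ.≤ n) where

    -- n ≤ s ^ k / k! < e ^ q for every q > s.
    logn-upper : ∀ k s → 0ℚ < s → ι n * ι (k !) ≤ s ^ℚ k → ¬ (logn n 3≤n ∋ s)
    logn-upper k s 0<s nk!≤s^k (q , (0<q , r , r<n , ¬exp∋r) , s<q) =
      ¬exp∋r (expSum q k , (k , refl) , <-≤-trans r<n (≤-trans n≤term (expTerm≤expSum q 0<q k)))
      where
      n≤term : ι n ≤ expTerm q k
      n≤term = *-cancelʳ-≤-pos (ι (k !)) {{positive (0<ι (k !) {{k ℕ.!≢0}})}} (begin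
        ι n * ι (k !)         ≤⟨ nk!≤s^k ⟩
        s ^ℚ k                ≤⟨ ^-monoˡ-≤ 0<s (<⇒≤ s<q) k ⟩
        q ^ℚ k                ≡⟨ sym (expTerm*! q k) ⟩
        expTerm q k * ι (k !) ∎)
        where open ≤-Reasoning

    -- The witness inside `1<logn` is 21/20 for every `n`, so it also shows log n > 26/25. Since
    -- e^(1/100) ≤ 1 + 1/100 + 1/100 < 26/25, every rational below 1/100 is below log log n.
    loglogn-lower : loglogn n 3≤n ∋ (+ 1 / 200)
    loglogn-lower = q , (0<q , + 26 / 25
      , (proj₁ (1<logn n 3≤n) , proj₁ (proj₂ (1<logn n 3≤n)) , toWitness {a? = + 26 / 25 <? + 21 / 20} _)
      , exp-upper q 0<q (λ k → ≤-trans (expSum-bound q 0<q 1 (toWitness {a? = q * (+ 1 / 2) ≤? ½} _) k)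
                                       (toWitness {a? = expSum q 1 + expTerm q 1 ≤? + 26 / 25} _)))
      , toWitness {a? = + 1 / 200 <? q} _
      where
      q = + 1 / 100
      0<q : 0ℚ < q
      0<q = toWitness {a? = 0ℚ <? q} _

  -- Raising `n` by one raises the integer root by at most one, as powers of consecutive bases
  -- differ by at least 1.
  root : ∀ k n → ∃ λ a → suc a ℕ.^ suc k ℕ.≤ suc n × suc n ℕ.≤ suc (suc a) ℕ.^ suc k
  root k zero = 0 , ℕ.≤-reflexive (ℕ.^-zeroˡ (suc k)) , ℕ.>-nonZero⁻¹ _ {{ℕ.m^n≢0 2 (suc k)}}
  root k (suc n) with root k n
  ... | a , lo , hi with suc (suc a) ℕ.^ suc k ℕ.≤? suc (suc n)
  ...   | no ¬≤ = a , ℕ.m≤n⇒m≤1+n lo , ℕ.<⇒≤ (ℕ.≰⇒> ¬≤)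
  ...   | yes ≤ = suc a , ≤ , ℕ.≤-trans (s≤s hi) (ℕ.^-monoˡ-< (suc k) ℕ.≤-refl)

  -- The two bases bracketing a root differ by a factor of at most 2, so exchanging them under a
  -- K-th power costs at most 2^K.
  ½≤ : ∀ a → ½ ≤ ι (suc a) * inv (suc a)
  ½≤ a = *-cancelʳ-≤-pos (ι (suc (suc a))) {{positive (0<ι (suc (suc a)))}} (begin
    ½ * ι (suc (suc a))
      ≤⟨ *-monoˡ-≤-nonNeg ½ (ι-mono-≤ (ℕ.≤-trans (s≤s (s≤s (ℕ.m≤m+n a a))) (ℕ.≤-reflexive (double a)))) ⟩
    ½ * ι (2 ℕ.* suc a)                         ≡⟨ cong (½ *_) (ι-* 2 (suc a)) ⟩
    ½ * (ι 2 * ι (suc a))                       ≡⟨ sym (*-assoc ½ (ι 2) (ι (suc a))) ⟩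
    ½ * ι 2 * ι (suc a)                         ≡⟨ *-identityˡ (ι (suc a)) ⟩
    ι (suc a)                                   ≡⟨ sym (*-identityʳ (ι (suc a))) ⟩
    ι (suc a) * 1ℚ                              ≡⟨ cong (ι (suc a) *_) (sym (inv*ι (suc a))) ⟩
    ι (suc a) * (inv (suc a) * ι (suc (suc a))) ≡⟨ sym (*-assoc (ι (suc a)) (inv (suc a)) _) ⟩
    ι (suc a) * inv (suc a) * ι (suc (suc a))   ∎)
    where
    open ≤-Reasoning
    double : ∀ a → suc (suc (a ℕ.+ a)) ≡ 2 ℕ.* suc a
    double a = cong suc (sym (trans (cong (a ℕ.+_) (cong suc (ℕ.+-identityʳ a))) (ℕ.+-suc a a)))

  ratio : ∀ n → 3 ℕ.≤ n → ℝ⁺ → ℝ⁺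
  ratio n 3≤n y = (loglogn n 3≤n ^ᵣ y) /ᵣ logn n 3≤n

  -- log n = O(n ^ (1/k)) for every k, and log log n is bounded away from 0.
  ratio-lower : ∀ y k → ∃ λ d → 0ℚ < d × ∀ n (3≤n : 3 ℕ.≤ n) →
    ∃ λ r → 0ℚ < r × r ≤ 1ℚ × ratio n 3≤n y ∋ r × d ≤ ι n * r ^ℚ suc k
  ratio-lower y k = D , 0<D , λ { (suc n) 3≤n → lower n 3≤n }
    where
    K = suc k
    -- Makes `inv F` equal to 1/K!.
    F = ℕ.pred (K !)
    sF≡K! : suc F ≡ K !
    sF≡K! = ℕ.suc-pred (K !) {{K ℕ.!≢0}}
    j = proj₁ (power-lower y)
    -- A lower bound for the power of log log n; the ½ provides the strict inequality that
    -- `power-lower` asks for.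
    c = ½ * (+ 1 / 200) ^ℚ suc j
    0<v : 0ℚ < (+ 1 / 200) ^ℚ suc j
    0<v = ^-pos (toWitness {a? = 0ℚ <? + 1 / 200} _) (suc j)
    v≤1 : (+ 1 / 200) ^ℚ suc j ≤ 1ℚ
    v≤1 = ^-≤1 (toWitness {a? = 0ℚ <? + 1 / 200} _) (toWitness {a? = + 1 / 200 ≤? 1ℚ} _) (suc j)
    0<c : 0ℚ < c
    0<c = *-pos 0<½ 0<v
    c≤1 : c ≤ 1ℚ
    c≤1 = ≤-trans (<⇒≤ (half< 0<v)) v≤1
    C = ½ * (c * inv F)
    0<C : 0ℚ < C
    0<C = *-pos 0<½ (*-pos 0<c (0<inv F))
    -- Below, r = C/(a+2) and `suc n` is at least (a+1)^K, so `suc n` times r^K is at least C^K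
    -- ((a+1)/(a+2))^K ≥ D.
    D = C ^ℚ K * ½ ^ℚ K
    0<D : 0ℚ < D
    0<D = *-pos (^-pos 0<C K) (^-pos 0<½ K)
    inv≤1 : ∀ i → inv i ≤ 1ℚ
    inv≤1 i = *-cancelʳ-≤-pos (ι (suc i)) {{positive (0<ι (suc i))}}
      (≤-trans (≤-reflexive (inv*ι i)) (≤-trans (ι-mono-≤ {1} {suc i} (s≤s z≤n)) (≤-reflexive (sym (*-identityˡ _)))))
    lower : ∀ n (3≤n : 3 ℕ.≤ suc n) → ∃ λ r → 0ℚ < r × r ≤ 1ℚ × ratio (suc n) 3≤n y ∋ r × D ≤ ι (suc n) * r ^ℚ K
    lower n 3≤n with a , lo , hi ← root k n = r , 0<r , r≤1 , ratio∋r , D≤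
      where
      L = loglogn (suc n) 3≤n ^ᵣ y
      -- An upper bound for the logarithm: s = K! (a+2) satisfies s^K ≥ K! (a+2)^K, which is at
      -- least K! times `suc n`.
      s = ι (suc F ℕ.* suc (suc a))
      t = c * (inv F * inv (suc a))
      r = ½ * t
      0<t : 0ℚ < t
      0<t = *-pos 0<c (*-pos (0<inv F) (0<inv (suc a)))
      0<r : 0ℚ < r
      0<r = *-pos 0<½ 0<t
      t≤1 : t ≤ 1ℚ
      t≤1 = *-mono-≤⁺ (<⇒≤ (*-pos (0<inv F) (0<inv (suc a)))) 0≤1 c≤1
        (*-mono-≤⁺ (<⇒≤ (0<inv (suc a))) 0≤1 (inv≤1 F) (inv≤1 (suc a)))
        where 0≤1 = toWitness {a? = 0ℚ ≤? 1ℚ} _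
      r≤1 : r ≤ 1ℚ
      r≤1 = ≤-trans (<⇒≤ (half< 0<t)) t≤1
      L∋c : L ∋ c
      L∋c = proj₂ (power-lower y) (loglogn (suc n) 3≤n)
        (toWitness {a? = 0ℚ <? + 1 / 200} _) (toWitness {a? = + 1 / 200 ≤? 1ℚ} _) (loglogn-lower (suc n) 3≤n)
        (half< 0<v)
      ts≡c : t * s ≡ c
      ts≡c = begin
        c * (inv F * inv (suc a)) * ι (suc F ℕ.* suc (suc a))
          ≡⟨ cong (t *_) (ι-* (suc F) (suc (suc a))) ⟩
        c * (inv F * inv (suc a)) * (ι (suc F) * ι (suc (suc a)))
          ≡⟨ solve 5 (λ c i j x y → c :* (i :* j) :* (x :* y) := c :* ((i :* x) :* (j :* y))) refl
               c (inv F) (inv (suc a)) (ι (suc F)) (ι (suc (suc a))) ⟩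
        c * (inv F * ι (suc F) * (inv (suc a) * ι (suc (suc a))))
          ≡⟨ cong₂ (λ x y → c * (x * y)) (inv*ι F) (inv*ι (suc a)) ⟩
        c * (1ℚ * 1ℚ)                                               ≡⟨ *-identityʳ c ⟩
        c                                                           ∎
        where open ≡-Reasoning
      n*K!≤s^K : ι (suc n) * ι (K !) ≤ s ^ℚ K
      n*K!≤s^K = begin
        ι (suc n) * ι (K !)                    ≡⟨ sym (ι-* (suc n) (K !)) ⟩
        ι (suc n ℕ.* K !)                      ≡⟨ cong (λ x → ι (suc n ℕ.* x)) (sym sF≡K!) ⟩
        ι (suc n ℕ.* suc F)
          ≤⟨ ι-mono-≤ (ℕ.*-mono-≤ hi (ℕ.m≤m*n (suc F) (suc F ℕ.^ k) {{ℕ.m^n≢0 (suc F) k}})) ⟩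
        ι (suc (suc a) ℕ.^ K ℕ.* suc F ℕ.^ K)
          ≡⟨ trans (ι-* (suc (suc a) ℕ.^ K) (suc F ℕ.^ K)) (cong₂ _*_ (ι-^ (suc (suc a)) K) (ι-^ (suc F) K)) ⟩
        ι (suc (suc a)) ^ℚ K * ι (suc F) ^ℚ K  ≡⟨ sym (^-distrib-* (ι (suc (suc a))) (ι (suc F)) K) ⟩
        (ι (suc (suc a)) * ι (suc F)) ^ℚ K
          ≡⟨ cong (_^ℚ K) (trans (*-comm (ι (suc (suc a))) (ι (suc F))) (sym (ι-* (suc F) (suc (suc a))))) ⟩
        s ^ℚ K                                 ∎
        where open ≤-Reasoning
      ratio∋r : ratio (suc n) 3≤n y ∋ r
      ratio∋r = /ᵣ-lower L (logn (suc n) 3≤n) L∋c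
        (logn-upper (suc n) 3≤n K s (0<ι (suc F ℕ.* suc (suc a))) n*K!≤s^K) ts≡c (half< 0<t)
      r≡ : r ≡ C * inv (suc a)
      r≡ = solve 4 (λ h c i j → h :* (c :* (i :* j)) := h :* (c :* i) :* j) refl ½ c (inv F) (inv (suc a))
      D≤ : D ≤ ι (suc n) * r ^ℚ K
      D≤ = begin
        C ^ℚ K * ½ ^ℚ K
          ≤⟨ *-monoˡ-≤-nonNeg (C ^ℚ K) {{nonNegative (<⇒≤ (^-pos 0<C K))}} (^-monoˡ-≤ 0<½ (½≤ a) K) ⟩
        C ^ℚ K * (ι (suc a) * inv (suc a)) ^ℚ K
          ≡⟨ cong (C ^ℚ K *_) (^-distrib-* (ι (suc a)) (inv (suc a)) K) ⟩
        C ^ℚ K * (ι (suc a) ^ℚ K * inv (suc a) ^ℚ K)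
          ≡⟨ cong (λ x → C ^ℚ K * (x * inv (suc a) ^ℚ K)) (sym (ι-^ (suc a) K)) ⟩
        C ^ℚ K * (ι (suc a ℕ.^ K) * inv (suc a) ^ℚ K)
          ≡⟨ solve 3 (λ x y z → x :* (y :* z) := y :* (x :* z)) refl (C ^ℚ K) (ι (suc a ℕ.^ K)) (inv (suc a) ^ℚ K) ⟩
        ι (suc a ℕ.^ K) * (C ^ℚ K * inv (suc a) ^ℚ K)
          ≡⟨ cong (ι (suc a ℕ.^ K) *_) (trans (sym (^-distrib-* C (inv (suc a)) K)) (cong (_^ℚ K) (sym r≡))) ⟩
        ι (suc a ℕ.^ K) * r ^ℚ K
          ≤⟨ *-monoʳ-≤-nonNeg (r ^ℚ K) {{nonNegative (<⇒≤ (^-pos 0<r K))}} (ι-mono-≤ lo) ⟩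
        ι (suc n) * r ^ℚ K                             ∎
        where open ≤-Reasoning

  -- The exponent `e` fixes `k`, and `ratio-lower` is then used with the root of the same order
  -- `suc k`, so the right-hand side is at least a constant over n. Membership in a cut is strict,
  -- which costs a factor 2 in `b` and another in `C`.
  bound-lower : ∀ A → .{{ℕ.NonZero A}} → (y e : ℝ⁺) → ∃ λ C → ∀ n (3≤n : 3 ℕ.≤ n) p →
    p * ι n ≤ ι A → p ≤ᵣ C *ᵣ ratio n 3≤n y ^ᵣ e
  bound-lower A y e = C , λ n 3≤n p pn≤A q q<p →
      let r , 0<r , r≤1 , ratio∋r , d≤ = proj₂ (proj₂ (ratio-lower y k)) n 3≤n
          b = ½ * r ^ℚ suc k
          0<b = *-pos 0<½ (^-pos 0<r (suc k))
      in *ᵣ-lower C (ratio n 3≤n y ^ᵣ e) 0<c 0<b c<c+c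
           (proj₂ (power-lower e) (ratio n 3≤n y) 0<r r≤1 ratio∋r (half< (^-pos 0<r (suc k))))
           (<-≤-trans q<p (p≤cb n 3≤n p r pn≤A d≤))
    where
    k = proj₁ (power-lower e)
    d = proj₁ (ratio-lower y k)
    0<d : 0ℚ < d
    0<d = proj₁ (proj₂ (ratio-lower y k))
    instance
      pos-½d : Positive (½ * d)
      pos-½d = positive (*-pos 0<½ 0<d)
      nz-½d : NonZero (½ * d)
      nz-½d = pos⇒nonZero (½ * d)
    0<1/ : 0ℚ < 1/ (½ * d)
    0<1/ = positive⁻¹ (1/ (½ * d)) {{1/pos⇒pos (½ * d)}}
    c = ι A * 1/ (½ * d)
    0<c : 0ℚ < c
    0<c = *-pos (0<ι A) 0<1/
    C : ℝ⁺
    C = fromℚ (c + c) (+-mono-< 0<c 0<c)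
    c<c+c : c < c + c
    c<c+c = subst (_< c + c) (+-identityˡ c) (+-monoˡ-< c 0<c)
    c*½d : c * (½ * d) ≡ ι A
    c*½d = trans (*-assoc (ι A) _ _) (trans (cong (ι A *_) (*-inverseˡ (½ * d))) (*-identityʳ (ι A)))
    p≤cb : ∀ n → 3 ℕ.≤ n → ∀ p r → p * ι n ≤ ι A → d ≤ ι n * r ^ℚ suc k → p ≤ c * (½ * r ^ℚ suc k)
    p≤cb (suc n) _ p r pn≤A d≤ = *-cancelʳ-≤-pos (ι (suc n)) {{positive (0<ι (suc n))}} (begin
      p * ι (suc n)                          ≤⟨ pn≤A ⟩
      ι A                                    ≡⟨ sym c*½d ⟩
      c * (½ * d)
        ≤⟨ *-monoˡ-≤-nonNeg c {{nonNegative (<⇒≤ 0<c)}} (*-monoˡ-≤-nonNeg ½ d≤) ⟩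
      c * (½ * (ι (suc n) * r ^ℚ suc k))
        ≡⟨ solve 4 (λ c h n r → c :* (h :* (n :* r)) := c :* (h :* r) :* n) refl c ½ (ι (suc n)) (r ^ℚ suc k) ⟩
      c * (½ * r ^ℚ suc k) * ι (suc n)       ∎)
      where open ≤-Reasoning

open Analysis using (bound-lower)
open Counting using (properConstant)
open Probability using (disconnected≤)
open import Data.Nat.Base using (ℕ; suc; s≤s; z≤n; _≤_; _<_)
open import Data.Nat.Properties using (≤-refl)
open import Data.Product.Base using (Σ; _,_; proj₁; proj₂)
open import Data.Rational.Base using (1ℚ; _-_; ∣_∣)

theorem4p3 : (m : ℕ) (1<m : 1 < m) (ε : ℝ⁺) →
    Σ ℝ⁺ λ C → Σ ℕ λ n₀ → (n : ℕ) (3≤n : 3 ≤ n) → n₀ ≤ n →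
    ∣ 1ℚ - ℙ (G m n) connected? ∣
    ≤ᵣ C *ᵣ ((loglogn n 3≤n ^ᵣ (1ℝ +ᵣ ε)) /ᵣ logn n 3≤n) ^ᵣ ([ m -1]/3 1<m)
-- From n = 8 on the induction step for the sum over proper cuts goes through.
theorem4p3 (suc (suc m)) 1<m@(s≤s (s≤s z≤n)) ε = proj₁ lower , 8 , λ n 3≤n 8≤n →
  proj₂ lower n 3≤n ∣ 1ℚ - ℙ (G (2 + m) n) connected? ∣ (disconnected≤ m ≤-refl 8≤n)
  where
  open import Data.Nat.Base using (_+_)
  lower = bound-lower (properConstant 8) (1ℝ +ᵣ ε) ([ 2 + m -1]/3 1<m)
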